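{- Let $A$ be a finite nonempty set of words over the alphabet $\{\mathtt 0,\mathtt 1\}$, all of which begin and end with $\mathtt 1$. Let $\ell$ be the length of the longest word in $A$ and let $a=a_A$. If $\ell\geq 2$ and $\mathtt 1\{\mathtt 0,\mathtt 1\}^{\ell-2}\mathtt 1\subset A$, then $a$ is noncorrelated. Conversely, if $2\leq \ell\leq 5$ and $a$ is noncorrelated, then $\mathtt 1\{\mathtt 0,\mathtt 1\}^{\ell-2}\mathtt 1\subset A$.
   Context: For a word $v$ over $\{\mathtt 0,\mathtt 1\}$ not of the form $\mathtt 0^j$ and $n\in\mathbb{N}_0$, $\#(v,n)$ is the number of pairs of words $(x,y)$ with $\mathtt 0^{|v|-1}(n)_2=xvy$, where $(n)_2$ is the binary expansion of $n$ without leading zeros (occurrences counted with overlaps). Then $a_A(n)=(-1)^{\sum_{v\in A}\#(v,n)}$. $\mathtt 1\{\mathtt 0,\mathtt 1\}^{\ell-2}\mathtt 1$ denotes the set of all words of length $\ell$ beginning and ending with $\mathtt 1$. For $a\colon\mathbb{N}_0\to\mathbb{C}$ and $m\in\mathbb{N}_0$, $\gamma_a(m)=\lim_{N\to\infty}\frac1N\sum_{n=0}^{N-1}a(n)\overline{a(n+m)}$; $a$ is noncorrelated if $\gamma_a(m)$ exists and equals $0$ for every $m\geq1$. -}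

module Defs where

open import Data.Bool using (Bool; true; false; if_then_else_; _xor_; _∧_)
open import Data.Nat using (ℕ; zero; suc; _+_; _*_; _∸_; _≤_; _⊔_; _/_; _%_; _≡ᵇ_)
open import Data.Integer as ℤ using (ℤ; ∣_∣)
open import Data.List using (List; []; _∷_; _++_; length; replicate; foldr)
open import Data.Maybe using (Maybe; just; nothing)
open import Data.Product using (∃; _×_)
open import Relation.Binary.PropositionalEquality using (_≡_)

-- Words over {0,1}: false = 0, true = 1.
Word : Set
Word = List Bool

-- binary expansion without leading zeros, most significant bit first;
-- (0)_2 is the empty word.  Fuel-based; fuel n always suffices.
binFuel : ℕ → ℕ → Word
binFuel zero    n = []
binFuel (suc f) n = if n ≡ᵇ 0 then [] else (binFuel f (n / 2) ++ ((n % 2 ≡ᵇ 1) ∷ []))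

bin : ℕ → Word
bin n = binFuel n n

bitEq : Bool → Bool → Bool
bitEq true  true  = true
bitEq false false = true
bitEq _     _     = false

isPrefix : Word → Word → Bool
isPrefix []       w        = true
isPrefix (x ∷ v)  []       = false
isPrefix (x ∷ v)  (y ∷ w)  = bitEq x y ∧ isPrefix v w

b2n : Bool → ℕ
b2n true  = 1
b2n false = 0

occ : Word → Word → ℕ
occ v []       = b2n (isPrefix v [])
occ v (c ∷ w)  = b2n (isPrefix v (c ∷ w)) + occ v w

count# : Word → ℕ → ℕ
count# v n = occ v (replicate (length v ∸ 1) false ++ bin n)

-- a_A(n) = (-1)^{Σ_{v∈A} #(v,n)}, A given as a duplicate-free list
isOdd : ℕ → Bool
isOdd n = n % 2 ≡ᵇ 1

sumCounts : List Word → ℕ → ℕ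
sumCounts A n = foldr (λ v s → count# v n + s) 0 A

aA : List Word → ℕ → ℤ
aA A n = if isOdd (sumCounts A n) then ℤ.-1ℤ else ℤ.1ℤ

-- Σ_{n<N} a(n) a(n+m)  (a is real-valued, so conjugation is trivial)
corrSum : (ℕ → ℤ) → ℕ → ℕ → ℤ
corrSum a m zero    = ℤ.0ℤ
corrSum a m (suc N) = corrSum a m N ℤ.+ (a N ℤ.* a (N ℕ.+ m))
  where import Data.Nat as ℕ

-- γ_a(m) exists and equals 0:  (1/N) Σ_{n<N} a(n)a(n+m) → 0, i.e.
-- for every ε = 1/(k+1) there is N₀ with |Σ| ≤ N/(k+1) for all N ≥ N₀.
CorrelationZero : (ℕ → ℤ) → ℕ → Set
CorrelationZero a m = ∀ (k : ℕ) → ∃ λ N₀ → ∀ N → N₀ ≤ N → ∣ corrSum a m N ∣ * suc k ≤ N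

Noncorrelated : (ℕ → ℤ) → Set
Noncorrelated a = ∀ m → 1 ≤ m → CorrelationZero a m

headW : Word → Maybe Bool
headW []      = nothing
headW (x ∷ _) = just x

lastW : Word → Maybe Bool
lastW []          = nothing
lastW (x ∷ [])    = just x
lastW (_ ∷ y ∷ w) = lastW (y ∷ w)

BeginsEndsWith1 : Word → Set
BeginsEndsWith1 w = (headW w ≡ just true) × (lastW w ≡ just true)

maxLen : List Word → ℕ
maxLen = foldr (λ w m → length w ⊔ m) 0

{-# OPTIONS --safe #-}
module Submission where

-- Write a(n) = (-1)^s(n). Deleting the last digit gives s(n) = E(n) + s(⌊n/2⌋) mod 2, where E(n)
-- counts the words of A that are suffixes of (n)₂; E vanishes at even n and depends only on the
-- last ℓ digits. Splitting n by parity expresses Σ h(n) a(n) a(n+d), for a sign h periodic modulo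
-- 2^(ℓ-1), through two such sums at ⌊d/2⌋ and ⌈d/2⌉ over half as many n, with new weights of
-- the same kind.
--
-- If A contains all words 1u1 of length ℓ, then E(n + 2^(ℓ-1)) = E(n) + 1 for odd n. Hence the
-- part of the d = 1 sum that reaches d = 0 has an antiperiodic weight and stays bounded, while the
-- other part is again a d = 1 sum of half the length; all correlations are therefore o(N).
--
-- For ℓ ≤ 5, unfolding the same recursion k times shows that the correlation at d over 2^k·16·Q
-- terms is Q·D up to an error 16·Q·d, where D is a polynomial in the 16 signs (-1)^E(1), …,
-- (-1)^E(31). Unless A contains all words 1u1 of length ℓ, |D| > 16·d for k = 8 and some d ≤ 7;
-- this is checked by specialising the sign variables of these polynomials one after another.

open import Defs
open import Data.Bool using (Bool; true; false; not; if_then_else_; _∧_; _∨_; _xor_; T)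
import Data.Bool.Properties as Bool
open import Data.Bool.Properties
  using (xor-same; xor-assoc; xor-identityʳ; not-involutive; not-distribˡ-xor; not-distribʳ-xor; ∧-zeroʳ)
open import Data.Bool.Solver using (module xor-∧-Solver)
open import Data.Nat
  using (ℕ; zero; suc; _+_; _*_; _^_; _∸_; _%_; _/_; _≤_; _<_; z≤n; s≤s; _<ᵇ_; ⌊_/2⌋; ⌈_/2⌉; NonZero; >-nonZero⁻¹; _≤?_)
open import Data.Nat.Properties
open import Data.Nat.Divisibility using (∣-refl)
open import Data.Nat.DivMod using (m≡m%n+[m/n]*n; m%n<n; +-distrib-/-∣ˡ)
open import Data.Nat.Solver using (module +-*-Solver)
open import Data.Integer as ℤ using (ℤ; ∣_∣; 0ℤ; 1ℤ; -1ℤ) renaming (+_ to pos)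
import Data.Integer.Properties as ℤ
import Data.Integer.Solver as ℤ
open import Data.List as List using (List; []; _∷_; _++_; length; reverse; replicate; foldr)
open import Data.List.Properties
  using (≡-dec; unfold-reverse; reverse-++; reverse-involutive; length-reverse; length-++)
open import Data.List.Relation.Unary.All as All using (All; []; _∷_)
open import Data.List.Relation.Unary.All.Properties using (map⁺)
open import Data.List.Relation.Unary.Any using (here; there)
open import Data.List.Relation.Unary.AllPairs using ([]; _∷_)
open import Data.List.Relation.Unary.Unique.Propositional using (Unique)
open import Data.List.Membership.Propositional using (_∈_; _∉_)
open import Data.Maybe using (just)
open import Data.Product using (_×_; _,_; proj₁; proj₂; ∃)
open import Data.Sum using (inj₁; inj₂)
open import Data.Unit using (tt)
open import Data.Vec as Vec using (Vec; []; _∷_)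
open import Function using (mk⇔)
open import Relation.Nullary using (yes; no; contradiction; does)
open import Relation.Nullary.Decidable using (dec-true; dec-false; does-⇔)
open import Relation.Binary.Definitions using (DecidableEquality)
open import Relation.Binary.PropositionalEquality

-- Sums of signs and correlations

odd : ℕ → Bool
odd zero    = false
odd (suc n) = not (odd n)

odd-+ : ∀ m n → odd (m + n) ≡ odd m xor odd n
odd-+ zero    n = refl
odd-+ (suc m) n = trans (cong not (odd-+ m n)) (not-distribˡ-xor (odd m) (odd n))

odd-+double : ∀ n m → odd (n + (m + m)) ≡ odd n
odd-+double n m = begin
  odd (n + (m + m))           ≡⟨ odd-+ n (m + m) ⟩
  odd n xor odd (m + m)       ≡⟨ cong (odd n xor_) (trans (odd-+ m m) (xor-same (odd m))) ⟩
  odd n xor false             ≡⟨ xor-identityʳ (odd n) ⟩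
  odd n                       ∎
  where open ≡-Reasoning

⌊n+n+m/2⌋ : ∀ n m → ⌊ n + n + m /2⌋ ≡ n + ⌊ m /2⌋
⌊n+n+m/2⌋ zero    m = refl
⌊n+n+m/2⌋ (suc n) m rewrite +-suc n n = cong suc (⌊n+n+m/2⌋ n m)

⌊1+n+n/2⌋ : ∀ n → ⌊ suc (n + n) /2⌋ ≡ n
⌊1+n+n/2⌋ n = trans (cong ⌊_/2⌋ (+-comm 1 (n + n))) (trans (⌊n+n+m/2⌋ n 1) (+-identityʳ n))

2^suc : ∀ j → 2 ^ suc j ≡ 2 ^ j + 2 ^ j
2^suc j = cong (2 ^ j +_) (+-identityʳ (2 ^ j))

sgn : Bool → ℤ
sgn b = if b then -1ℤ else 1ℤ

sgn-xor : ∀ a b → sgn (a xor b) ≡ sgn a ℤ.* sgn b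
sgn-xor true  true  = refl
sgn-xor true  false = refl
sgn-xor false true  = refl
sgn-xor false false = refl

∣sgn∣ : ∀ b → ∣ sgn b ∣ ≡ 1
∣sgn∣ true  = refl
∣sgn∣ false = refl

Σ± : (ℕ → Bool) → ℕ → ℤ
Σ± f zero    = 0ℤ
Σ± f (suc N) = Σ± f N ℤ.+ sgn (f N)

Σ±-cong : ∀ {f g} → (∀ n → f n ≡ g n) → ∀ N → Σ± f N ≡ Σ± g N
Σ±-cong eq zero    = refl
Σ±-cong eq (suc N) = cong₂ (λ x b → x ℤ.+ sgn b) (Σ±-cong eq N) (eq N)

∣Σ±∣≤ : ∀ f N → ∣ Σ± f N ∣ ≤ N
∣Σ±∣≤ f zero    = z≤n
∣Σ±∣≤ f (suc N) = begin
  ∣ Σ± f N ℤ.+ sgn (f N) ∣      ≤⟨ ℤ.∣i+j∣≤∣i∣+∣j∣ (Σ± f N) (sgn (f N)) ⟩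
  ∣ Σ± f N ∣ + ∣ sgn (f N) ∣    ≤⟨ +-mono-≤ (∣Σ±∣≤ f N) (≤-reflexive (∣sgn∣ (f N))) ⟩
  N + 1                         ≡⟨ +-comm N 1 ⟩
  suc N                         ∎
  where open ≤-Reasoning

Σ±-+ : ∀ f M N → Σ± f (M + N) ≡ Σ± f M ℤ.+ Σ± (λ n → f (M + n)) N
Σ±-+ f M zero    = trans (cong (Σ± f) (+-identityʳ M)) (sym (ℤ.+-identityʳ _))
Σ±-+ f M (suc N) = begin
  Σ± f (M + suc N)                                                  ≡⟨ cong (Σ± f) (+-suc M N) ⟩
  Σ± f (M + N) ℤ.+ sgn (f (M + N))
    ≡⟨ cong (ℤ._+ sgn (f (M + N))) (Σ±-+ f M N) ⟩
  (Σ± f M ℤ.+ Σ± (λ n → f (M + n)) N) ℤ.+ sgn (f (M + N))           ≡⟨ ℤ.+-assoc (Σ± f M) _ _ ⟩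
  Σ± f M ℤ.+ (Σ± (λ n → f (M + n)) N ℤ.+ sgn (f (M + N)))           ∎
  where open ≡-Reasoning

-- Induction in steps of two: the terms 0 and 1 are peeled off and `f` is shifted by 2. Of the first
-- `N` integers, `⌈ N /2⌉` are even.
Σ±-split : ∀ f N →
  Σ± f N ≡ Σ± (λ n → f (n + n)) ⌈ N /2⌉ ℤ.+ Σ± (λ n → f (suc (n + n))) ⌊ N /2⌋
Σ±-split f zero          = refl
Σ±-split f (suc zero)    = sym (ℤ.+-identityʳ _)
Σ±-split f (suc (suc N)) = begin
  Σ± f (2 + N)
    ≡⟨ Σ±-+ f 2 N ⟩
  Σ± f 2 ℤ.+ Σ± (λ n → f (2 + n)) N
    ≡⟨ cong (λ x → Σ± f 2 ℤ.+ x) (Σ±-split (λ n → f (2 + n)) N) ⟩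
  Σ± f 2 ℤ.+ (Σ± (λ n → f (2 + (n + n))) ⌈ N /2⌉ ℤ.+ Σ± (λ n → f (3 + (n + n))) ⌊ N /2⌋)
    ≡⟨ cong (λ x → Σ± f 2 ℤ.+ x) (cong₂ ℤ._+_
         (Σ±-cong (λ n → cong (λ k → f (suc k)) (sym (+-suc n n))) ⌈ N /2⌉)
         (Σ±-cong (λ n → cong (λ k → f (2 + k)) (sym (+-suc n n))) ⌊ N /2⌋)) ⟩
  Σ± f 2 ℤ.+ (Σ± (λ n → even (1 + n)) ⌈ N /2⌉ ℤ.+ Σ± (λ n → odds (1 + n)) ⌊ N /2⌋)
    ≡⟨ solve 5 (λ z a b c d → ((z :+ a) :+ b) :+ (c :+ d) := ((z :+ a) :+ c) :+ (con 0ℤ :+ b :+ d))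
         refl 0ℤ (sgn (f 0)) (sgn (f 1)) _ _ ⟩
  (Σ± even 1 ℤ.+ Σ± (λ n → even (1 + n)) ⌈ N /2⌉) ℤ.+ (Σ± odds 1 ℤ.+ Σ± (λ n → odds (1 + n)) ⌊ N /2⌋)
    ≡⟨ cong₂ ℤ._+_ (Σ±-+ even 1 ⌈ N /2⌉) (Σ±-+ odds 1 ⌊ N /2⌋) ⟨
  Σ± even (suc ⌈ N /2⌉) ℤ.+ Σ± odds (suc ⌊ N /2⌋) ∎
  where
  open ≡-Reasoning
  open ℤ.+-*-Solver
  even odds : ℕ → Bool
  even n = f (n + n)
  odds n = f (suc (n + n))

module Correlations (s E : ℕ → Bool) (s-rec : ∀ n → s n ≡ E n xor s ⌊ n /2⌋) where

  -- Signs are kept as exponents modulo 2, so that their products become `xor`; `h` is the weight.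
  corr : (ℕ → Bool) → ℕ → ℕ → ℤ
  corr h d = Σ± (λ n → h n xor (s n xor s (n + d)))

  lift : ℕ → ℕ → (ℕ → Bool) → ℕ → Bool
  lift δ d h n = h (δ + (n + n)) xor (E (δ + (n + n)) xor E (δ + (n + n) + d))

  -- Halving `n + n + d` gives `n + ⌊ d /2⌋`, and halving `suc (n + n) + d` gives `n + ⌈ d /2⌉`.
  -- After `s-rec` is applied to both factors, the two values of `E` are absorbed into the weight;
  -- this is what `lift` records.
  corr-split : ∀ h d N →
    corr h d N ≡ corr (lift 0 d h) ⌊ d /2⌋ ⌈ N /2⌉ ℤ.+ corr (lift 1 d h) ⌈ d /2⌉ ⌊ N /2⌋
  corr-split h d N = trans (Σ±-split _ N) (cong₂ ℤ._+_
    (Σ±-cong (λ n → regroup (n + n) (sym (n≡⌊n+n/2⌋ n)) (⌊n+n+m/2⌋ n d)) ⌈ N /2⌉)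
    (Σ±-cong (λ n → regroup (suc (n + n)) (⌊1+n+n/2⌋ n)
      (trans (cong ⌊_/2⌋ (sym (+-suc (n + n) d))) (⌊n+n+m/2⌋ n (suc d)))) ⌊ N /2⌋))
    where
    regroup : ∀ x {y z} → ⌊ x /2⌋ ≡ y → ⌊ x + d /2⌋ ≡ z →
      h x xor (s x xor s (x + d)) ≡ (h x xor (E x xor E (x + d))) xor (s y xor s z)
    regroup x refl refl rewrite s-rec x | s-rec (x + d) =
      solve 5 (λ a b c e f → a :+ ((b :+ c) :+ (e :+ f)) := (a :+ (b :+ e)) :+ (c :+ f))
        refl (h x) (E x) (s ⌊ x /2⌋) (E (x + d)) (s ⌊ x + d /2⌋)
      where open xor-∧-Solver

-- Periodic and antiperiodic signs; upper bounds for correlations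

Periodic : ℕ → (ℕ → Bool) → Set
Periodic q h = ∀ n → h (n + q) ≡ h n

Σ±-not : ∀ f N → Σ± (λ n → not (f n)) N ≡ ℤ.- Σ± f N
Σ±-not f zero    = refl
Σ±-not f (suc N) = begin
  Σ± (λ n → not (f n)) N ℤ.+ sgn (not (f N))   ≡⟨ cong₂ ℤ._+_ (Σ±-not f N) (sgn-not (f N)) ⟩
  (ℤ.- Σ± f N) ℤ.+ (ℤ.- sgn (f N))             ≡⟨ ℤ.neg-distrib-+ (Σ± f N) (sgn (f N)) ⟨
  ℤ.- (Σ± f N ℤ.+ sgn (f N))                   ∎
  where
  open ≡-Reasoning
  sgn-not : ∀ b → sgn (not b) ≡ ℤ.- sgn b
  sgn-not true  = refl
  sgn-not false = refl

Σ±-periods : ∀ {q h} → Periodic q h → ∀ m r → Σ± h (m * q + r) ≡ pos m ℤ.* Σ± h q ℤ.+ Σ± h r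
Σ±-periods {q} {h} per zero    r = sym (ℤ.+-identityˡ (Σ± h r))
Σ±-periods {q} {h} per (suc m) r = begin
  Σ± h (q + m * q + r)                                 ≡⟨ cong (Σ± h) (+-assoc q (m * q) r) ⟩
  Σ± h (q + (m * q + r))                               ≡⟨ Σ±-+ h q (m * q + r) ⟩
  Σ± h q ℤ.+ Σ± (λ n → h (q + n)) (m * q + r)          ≡⟨ cong (λ z → Σ± h q ℤ.+ z) (Σ±-cong
                                                            (λ n → trans (cong h (+-comm q n)) (per n)) (m * q + r)) ⟩
  Σ± h q ℤ.+ Σ± h (m * q + r)                          ≡⟨ cong (λ z → Σ± h q ℤ.+ z) (Σ±-periods per m r) ⟩
  Σ± h q ℤ.+ (pos m ℤ.* Σ± h q ℤ.+ Σ± h r)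
    ≡⟨ solve 3 (λ x y m → x :+ (m :* x :+ y) := (con 1ℤ :+ m) :* x :+ y)
                                                            refl (Σ± h q) (Σ± h r) (pos m) ⟩
  pos (suc m) ℤ.* Σ± h q ℤ.+ Σ± h r                        ∎
  where
  open ≡-Reasoning
  open ℤ.+-*-Solver

-- The two halves of a period of length `p + p` cancel, so only the last incomplete period
-- contributes.
∣Σ±-antiperiodic∣≤ : ∀ {p g} .{{_ : NonZero (p + p)}} → (∀ n → g (n + p) ≡ not (g n)) →
  ∀ N → ∣ Σ± g N ∣ ≤ p + p
∣Σ±-antiperiodic∣≤ {p} {g} anti N = begin
  ∣ Σ± g N ∣
    ≡⟨ cong (λ x → ∣ Σ± g x ∣) (trans (m≡m%n+[m/n]*n N P) (+-comm (N % P) (N / P * P))) ⟩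
  ∣ Σ± g (N / P * P + N % P) ∣                          ≡⟨ cong ∣_∣ (Σ±-periods periodic (N / P) (N % P)) ⟩
  ∣ pos (N / P) ℤ.* Σ± g P ℤ.+ Σ± g (N % P) ∣
    ≡⟨ cong (λ x → ∣ pos (N / P) ℤ.* x ℤ.+ Σ± g (N % P) ∣) full-period ⟩
  ∣ pos (N / P) ℤ.* 0ℤ ℤ.+ Σ± g (N % P) ∣
    ≡⟨ cong (λ x → ∣ x ℤ.+ Σ± g (N % P) ∣) (ℤ.*-zeroʳ (pos (N / P))) ⟩
  ∣ 0ℤ ℤ.+ Σ± g (N % P) ∣                               ≡⟨ cong ∣_∣ (ℤ.+-identityˡ (Σ± g (N % P))) ⟩
  ∣ Σ± g (N % P) ∣                                      ≤⟨ ∣Σ±∣≤ g (N % P) ⟩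
  N % P                                                 ≤⟨ <⇒≤ (m%n<n N P) ⟩
  P                                                     ∎
  where
  open ≤-Reasoning
  P : ℕ
  P = p + p
  periodic : Periodic P g
  periodic n = trans (cong g (sym (+-assoc n p p)))
    (trans (anti (n + p)) (trans (cong not (anti n)) (not-involutive (g n))))
  full-period : Σ± g P ≡ 0ℤ
  full-period = trans (Σ±-+ g p p) (trans (cong (λ z → Σ± g p ℤ.+ z) (trans
    (Σ±-cong (λ n → trans (cong g (+-comm p n)) (anti n)) p) (Σ±-not g p)))
    (ℤ.+-inverseʳ (Σ± g p)))

double-cancel-≤ : ∀ {m n} → m + m ≤ n + n → m ≤ n
double-cancel-≤ {m} {n} le = subst₂ _≤_ (sym (n≡⌊n+n/2⌋ m)) (sym (n≡⌊n+n/2⌋ n)) (⌊n/2⌋-mono le)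

module CorrelationBounds (s E : ℕ → Bool) (s-rec : ∀ n → s n ≡ E n xor s ⌊ n /2⌋) where
  open Correlations s E s-rec

  corr-0 : ∀ h N → corr h 0 N ≡ Σ± h N
  corr-0 h N = Σ±-cong (λ n → begin
    h n xor (s n xor s (n + 0))   ≡⟨ cong (λ k → h n xor (s n xor s k)) (+-identityʳ n) ⟩
    h n xor (s n xor s n)         ≡⟨ cong (h n xor_) (xor-same (s n)) ⟩
    h n xor false                 ≡⟨ xor-identityʳ (h n) ⟩
    h n                           ∎) N
    where open ≡-Reasoning

  -- The period of the weight does not grow: moving `n` by `q` moves the argument by `q + q`, which
  -- is a period of `E` and twice a period of `h`.
  lift-periodic : ∀ {q h} → Periodic (q + q) E → Periodic q h → ∀ δ d → Periodic q (lift δ d h)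
  lift-periodic {q} {h} E-per h-per δ d n = cong₂ _xor_
    (trans (cong h move₁) (trans (h-per _) (h-per _)))
    (cong₂ _xor_ (trans (cong E move₂) (E-per _)) (trans (cong E move₃) (E-per _)))
    where
    open +-*-Solver
    move₁ : δ + (n + q + (n + q)) ≡ δ + (n + n) + q + q
    move₁ = solve 3 (λ δ n q → δ :+ (n :+ q :+ (n :+ q)) := δ :+ (n :+ n) :+ q :+ q) refl δ n q
    move₂ : δ + (n + q + (n + q)) ≡ δ + (n + n) + (q + q)
    move₂ = solve 3 (λ δ n q → δ :+ (n :+ q :+ (n :+ q)) := δ :+ (n :+ n) :+ (q :+ q)) refl δ n q
    move₃ : δ + (n + q + (n + q)) + d ≡ δ + (n + n) + d + (q + q)
    move₃ = solve 4 (λ δ n q d → δ :+ (n :+ q :+ (n :+ q)) :+ d := δ :+ (n :+ n) :+ d :+ (q :+ q)) refl δ n q d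

  -- The hypothesis `E-flip` is what a full set of longest words provides, with `p` = 2^(ℓ-2), so
  -- that the shift `p + p` changes the leading one of the last ℓ digits.
  module Flipping (p : ℕ) .{{_ : NonZero (p + p)}}
    (E-flip : ∀ x → E (x + (p + p)) ≡ odd x xor E x) where

    P : ℕ
    P = p + p

    E-periodic : Periodic (P + P) E
    E-periodic x = begin
      E (x + (P + P))                ≡⟨ cong E (+-assoc x P P) ⟨
      E (x + P + P)                  ≡⟨ E-flip (x + P) ⟩
      odd (x + P) xor E (x + P)      ≡⟨ cong₂ _xor_ (odd-+double x p) (E-flip x) ⟩
      odd x xor (odd x xor E x)      ≡⟨ xor-assoc (odd x) (odd x) (E x) ⟨
      (odd x xor odd x) xor E x      ≡⟨ cong (_xor E x) (xor-same (odd x)) ⟩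
      E x                            ∎
      where open ≡-Reasoning

    -- Moving `n` by `p` moves both arguments `n + n` and `n + n + 1` by `P`. Only the odd one flips
    -- its value of `E`, and `h` does not change.
    lift-antiperiodic : ∀ {h} → Periodic P h → ∀ n → lift 0 1 h (n + p) ≡ not (lift 0 1 h n)
    lift-antiperiodic {h} h-per n = begin
      h (n + p + (n + p)) xor (E (n + p + (n + p)) xor E (n + p + (n + p) + 1))
        ≡⟨ cong₂ (λ x y → h x xor (E x xor E y)) move₁ move₂ ⟩
      h (n + n + P) xor (E (n + n + P) xor E (n + n + 1 + P))
        ≡⟨ cong₂ _xor_ (h-per (n + n)) (cong₂ _xor_ (E-flip (n + n)) (E-flip (n + n + 1))) ⟩
      h (n + n) xor ((odd (n + n) xor E (n + n)) xor (odd (n + n + 1) xor E (n + n + 1)))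
        ≡⟨ cong₂ (λ x y → h (n + n) xor ((x xor E (n + n)) xor (y xor E (n + n + 1))))
             (odd-+double 0 n) (trans (cong odd (+-comm (n + n) 1)) (cong not (odd-+double 0 n))) ⟩
      h (n + n) xor (E (n + n) xor not (E (n + n + 1)))
        ≡⟨ cong (h (n + n) xor_) (not-distribʳ-xor (E (n + n)) _) ⟨
      h (n + n) xor not (E (n + n) xor E (n + n + 1))
        ≡⟨ not-distribʳ-xor (h (n + n)) _ ⟨
      not (h (n + n) xor (E (n + n) xor E (n + n + 1))) ∎
      where
      open ≡-Reasoning
      open +-*-Solver
      move₁ : n + p + (n + p) ≡ n + n + P
      move₁ = solve 2 (λ n p → n :+ p :+ (n :+ p) := n :+ n :+ (p :+ p)) refl n p
      move₂ : n + p + (n + p) + 1 ≡ n + n + 1 + P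
      move₂ = solve 2 (λ n p → n :+ p :+ (n :+ p) :+ con 1 := n :+ n :+ con 1 :+ (p :+ p)) refl n p

    module _ (k : ℕ) .{{_ : NonZero k}} where

      -- For N ≤ 2 P k the trivial bound gives |corr h d N| * k ≤ c; for larger N the bounded
      -- antiperiodic part is at most ⌈ N /2⌉.
      c : ℕ
      c = (P * k + P * k) * k

      ∣corr-split∣ : ∀ h d N {x y} →
        ∣ corr (lift 0 d h) ⌊ d /2⌋ ⌈ N /2⌉ ∣ * k ≤ x →
        ∣ corr (lift 1 d h) ⌈ d /2⌉ ⌊ N /2⌋ ∣ * k ≤ y →
        ∣ corr h d N ∣ * k ≤ x + y
      ∣corr-split∣ h d N {x} {y} a≤x b≤y = begin
        ∣ corr h d N ∣ * k       ≡⟨ cong (λ z → ∣ z ∣ * k) (corr-split h d N) ⟩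
        ∣ a ℤ.+ b ∣ * k          ≤⟨ *-monoˡ-≤ k (ℤ.∣i+j∣≤∣i∣+∣j∣ a b) ⟩
        (∣ a ∣ + ∣ b ∣) * k      ≡⟨ *-distribʳ-+ k ∣ a ∣ ∣ b ∣ ⟩
        ∣ a ∣ * k + ∣ b ∣ * k    ≤⟨ +-mono-≤ a≤x b≤y ⟩
        x + y                    ∎
        where
        open ≤-Reasoning
        a b : ℤ
        a = corr (lift 0 d h) ⌊ d /2⌋ ⌈ N /2⌉
        b = corr (lift 1 d h) ⌈ d /2⌉ ⌊ N /2⌋

      ⌈/2⌉+⌊/2⌋ : ∀ N x y → (⌈ N /2⌉ + x) + (⌊ N /2⌋ + y) ≡ N + (x + y)
      ⌈/2⌉+⌊/2⌋ N x y = begin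
        (⌈ N /2⌉ + x) + (⌊ N /2⌋ + y)
          ≡⟨ solve 4 (λ a b x y → (a :+ x) :+ (b :+ y) := (b :+ a) :+ (x :+ y)) refl ⌈ N /2⌉ ⌊ N /2⌋ x y ⟩
        (⌊ N /2⌋ + ⌈ N /2⌉) + (x + y)  ≡⟨ cong (_+ (x + y)) (⌊n/2⌋+⌈n/2⌉≡n N) ⟩
        N + (x + y)                    ∎
        where
        open ≡-Reasoning
        open +-*-Solver

      -- The bound is additive under `corr-split`: the halves of `N` sum to `N` and the halved
      -- distances sum to the distance. At distance 1 the even half has distance 0 and is controlled
      -- by antiperiodicity, so `c` is charged only to the odd half. `F` is fuel for the halving of
      -- `N`.
      ∣corr∣*k≤ : ∀ F N → N ≤ F → ∀ d h → Periodic P h →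
        ∣ corr h (suc d) N ∣ * k ≤ N + suc d * c
      ∣corr∣*k≤ zero    .zero z≤n d h h-per = z≤n
      ∣corr∣*k≤ (suc F) N     N≤F d h h-per with N ≤? P * k + P * k
      ... | yes N≤2Pk = begin
        ∣ corr h (suc d) N ∣ * k   ≤⟨ *-monoˡ-≤ k (∣Σ±∣≤ _ N) ⟩
        N * k                      ≤⟨ *-monoˡ-≤ k N≤2Pk ⟩
        c                          ≤⟨ m≤m+n c (d * c) ⟩
        suc d * c                  ≤⟨ m≤n+m _ N ⟩
        N + suc d * c              ∎
        where open ≤-Reasoning
      ... | no N≰2Pk = step d
        where
        open ≤-Reasoning
        N>2Pk : P * k + P * k < N
        N>2Pk = ≰⇒> N≰2Pk
        Pk≤⌊N/2⌋ : P * k ≤ ⌊ N /2⌋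
        Pk≤⌊N/2⌋ = subst (_≤ ⌊ N /2⌋) (sym (n≡⌊n+n/2⌋ (P * k))) (⌊n/2⌋-mono (<⇒≤ N>2Pk))
        0<P*k : 0 < P * k
        0<P*k = >-nonZero⁻¹ (P * k) {{m*n≢0 P k}}
        -- Rounding up decreases `N` only if `N` is at least 2, which follows from `N` > 2 `P` `k` >
        -- 0.
        ⌈N/2⌉≤F : ⌈ N /2⌉ ≤ F
        ⌈N/2⌉≤F = shrink N N≤F (<-≤-trans (s≤s (≤-trans 0<P*k (m≤m+n _ _))) N>2Pk)
          where
          shrink : ∀ N → N ≤ suc F → 2 ≤ N → ⌈ N /2⌉ ≤ F
          shrink (suc (suc N)) (s≤s N≤F) _ = ≤-trans (≤-pred (⌈n/2⌉<n N)) N≤F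
          shrink (suc zero) _ (s≤s ())
        ⌊N/2⌋≤F : ⌊ N /2⌋ ≤ F
        ⌊N/2⌋≤F = ≤-trans (⌊n/2⌋≤⌈n/2⌉ N) ⌈N/2⌉≤F
        lifted : ∀ δ d → Periodic P (lift δ d h)
        lifted = lift-periodic E-periodic h-per
        step : ∀ d → ∣ corr h (suc d) N ∣ * k ≤ N + suc d * c
        step zero = begin
          ∣ corr h 1 N ∣ * k
            ≤⟨ ∣corr-split∣ h 1 N antiperiodic-part (∣corr∣*k≤ F ⌊ N /2⌋ ⌊N/2⌋≤F 0 _ (lifted 1 1)) ⟩
          (⌈ N /2⌉ + 0) + (⌊ N /2⌋ + (c + 0))           ≡⟨ ⌈/2⌉+⌊/2⌋ N 0 (c + 0) ⟩
          N + (c + 0)                                   ∎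
          where
          antiperiodic-part : ∣ corr (lift 0 1 h) 0 ⌈ N /2⌉ ∣ * k ≤ ⌈ N /2⌉ + 0
          antiperiodic-part = begin
            ∣ corr (lift 0 1 h) 0 ⌈ N /2⌉ ∣ * k   ≡⟨ cong (λ z → ∣ z ∣ * k) (corr-0 (lift 0 1 h) ⌈ N /2⌉) ⟩
            ∣ Σ± (lift 0 1 h) ⌈ N /2⌉ ∣ * k
              ≤⟨ *-monoˡ-≤ k (∣Σ±-antiperiodic∣≤ (lift-antiperiodic h-per) ⌈ N /2⌉) ⟩
            P * k                                 ≤⟨ Pk≤⌊N/2⌋ ⟩
            ⌊ N /2⌋                               ≤⟨ ⌊n/2⌋≤⌈n/2⌉ N ⟩
            ⌈ N /2⌉                               ≡⟨ +-identityʳ _ ⟨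
            ⌈ N /2⌉ + 0                           ∎
        step (suc d) = begin
          ∣ corr h (2 + d) N ∣ * k
            ≤⟨ ∣corr-split∣ h (2 + d) N (∣corr∣*k≤ F ⌈ N /2⌉ ⌈N/2⌉≤F ⌊ d /2⌋ _ (lifted 0 (2 + d)))
                                        (∣corr∣*k≤ F ⌊ N /2⌋ ⌊N/2⌋≤F ⌈ d /2⌉ _ (lifted 1 (2 + d))) ⟩
          (⌈ N /2⌉ + suc ⌊ d /2⌋ * c) + (⌊ N /2⌋ + suc ⌈ d /2⌉ * c)
            ≡⟨ ⌈/2⌉+⌊/2⌋ N _ _ ⟩
          N + (suc ⌊ d /2⌋ * c + suc ⌈ d /2⌉ * c)
            ≡⟨ cong (N +_) (solve 3 (λ a b c → (con 1 :+ a) :* c :+ (con 1 :+ b) :* c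
                 := (con 2 :+ (a :+ b)) :* c) refl ⌊ d /2⌋ ⌈ d /2⌉ c) ⟩
          N + (2 + (⌊ d /2⌋ + ⌈ d /2⌉)) * c
            ≡⟨ cong (λ x → N + (2 + x) * c) (⌊n/2⌋+⌈n/2⌉≡n d) ⟩
          N + (2 + d) * c ∎
          where open +-*-Solver

    corr-negligible : ∀ d k → ∃ λ N₀ → ∀ N → N₀ ≤ N → ∣ corr (λ _ → false) (suc d) N ∣ * suc k ≤ N
    -- The bound is applied with twice the factor `suc k`: once `N` exceeds the constant term, the
    -- right side is at most `N + N`, and the 2 cancels.
    corr-negligible d k = suc d * c (suc k + suc k) , λ N N₀≤N → double-cancel-≤ (begin
      ∣ x N ∣ * suc k + ∣ x N ∣ * suc k            ≡⟨ *-distribˡ-+ ∣ x N ∣ (suc k) (suc k) ⟨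
      ∣ x N ∣ * (suc k + suc k)
        ≤⟨ ∣corr∣*k≤ (suc k + suc k) N N ≤-refl d (λ _ → false) (λ _ → refl) ⟩
      N + suc d * c (suc k + suc k)                ≤⟨ +-monoʳ-≤ N N₀≤N ⟩
      N + N                                        ∎)
      where
      open ≤-Reasoning
      x : ℕ → ℤ
      x = corr (λ _ → false) (suc d)

  -- Main terms of correlations over long blocks

  module BlockSums (q : ℕ) .{{_ : NonZero q}} (E-per : Periodic (q + q) E) where

    -- The contribution to corr h d of a block of 2^k q integers, ignoring those n for which the
    -- carries of n + d have not died out after k digits.
    main : ℕ → ℕ → (ℕ → Bool) → ℤ
    main k       zero    h = pos (2 ^ k) ℤ.* Σ± h q
    main zero    (suc d) h = 0ℤ
    main (suc k) (suc d) h =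
      main k ⌊ suc d /2⌋ (lift 0 (suc d) h) ℤ.+ main k ⌈ suc d /2⌉ (lift 1 (suc d) h)

    -- At distance 0 the formula is exact, by periodicity of the weight. At depth 0 and positive
    -- distance there are `Q * q` terms, bounded trivially. Each split distributes the error in
    -- proportion to the halved distances, whose sum is `d`.
    corr-approx : ∀ k d {h} → Periodic q h → ∀ Q →
      ∣ corr h d (2 ^ k * (Q * q)) ℤ.- pos Q ℤ.* main k d h ∣ ≤ Q * q * d
    corr-approx k zero {h} h-per Q = ≤-trans (≤-reflexive (cong ∣_∣ (ℤ.i≡j⇒i-j≡0 (begin
      corr h 0 (2 ^ k * (Q * q))                        ≡⟨ corr-0 h (2 ^ k * (Q * q)) ⟩
      Σ± h (2 ^ k * (Q * q))
        ≡⟨ cong (Σ± h) (trans (sym (*-assoc (2 ^ k) Q q)) (sym (+-identityʳ _))) ⟩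
      Σ± h (2 ^ k * Q * q + 0)                          ≡⟨ Σ±-periods h-per (2 ^ k * Q) 0 ⟩
      pos (2 ^ k * Q) ℤ.* Σ± h q ℤ.+ 0ℤ
        ≡⟨ cong (λ x → x ℤ.* Σ± h q ℤ.+ 0ℤ) (ℤ.pos-* (2 ^ k) Q) ⟩
      pos (2 ^ k) ℤ.* pos Q ℤ.* Σ± h q ℤ.+ 0ℤ
        ≡⟨ solve 3 (λ a b c → a :* b :* c :+ con 0ℤ := b :* (a :* c)) refl (pos (2 ^ k)) (pos Q) (Σ± h q) ⟩
      pos Q ℤ.* (pos (2 ^ k) ℤ.* Σ± h q)                    ∎)))) z≤n
      where
      open ≡-Reasoning
      open ℤ.+-*-Solver
    corr-approx zero (suc d) {h} h-per Q = begin
      ∣ x ℤ.- pos Q ℤ.* 0ℤ ∣     ≡⟨ cong (λ y → ∣ x ℤ.- y ∣) (ℤ.*-zeroʳ (pos Q)) ⟩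
      ∣ x ℤ.- 0ℤ ∣             ≡⟨ cong ∣_∣ (ℤ.+-identityʳ x) ⟩
      ∣ x ∣                    ≤⟨ ∣Σ±∣≤ _ (1 * (Q * q)) ⟩
      1 * (Q * q)              ≡⟨ *-comm 1 (Q * q) ⟩
      Q * q * 1                ≤⟨ *-monoʳ-≤ (Q * q) (s≤s z≤n) ⟩
      Q * q * suc d            ∎
      where
      open ≤-Reasoning
      x : ℤ
      x = corr h (suc d) (1 * (Q * q))
    corr-approx (suc k) (suc d) {h} h-per Q = begin
      ∣ corr h (suc d) (2 ^ suc k * (Q * q)) ℤ.- pos Q ℤ.* (A ℤ.+ B) ∣
        ≡⟨ cong (λ z → ∣ z ℤ.- pos Q ℤ.* (A ℤ.+ B) ∣) halves ⟩
      ∣ (a ℤ.+ b) ℤ.- pos Q ℤ.* (A ℤ.+ B) ∣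
        ≡⟨ cong ∣_∣ (solve 5 (λ a b A B Q → (a :+ b) :- Q :* (A :+ B) := (a :- Q :* A) :+ (b :- Q :* B))
             refl a b A B (pos Q)) ⟩
      ∣ (a ℤ.- pos Q ℤ.* A) ℤ.+ (b ℤ.- pos Q ℤ.* B) ∣
        ≤⟨ ℤ.∣i+j∣≤∣i∣+∣j∣ (a ℤ.- pos Q ℤ.* A) _ ⟩
      ∣ a ℤ.- pos Q ℤ.* A ∣ + ∣ b ℤ.- pos Q ℤ.* B ∣
        ≤⟨ +-mono-≤ (corr-approx k ⌊ suc d /2⌋ (lift-periodic E-per h-per 0 (suc d)) Q)
                    (corr-approx k ⌈ suc d /2⌉ (lift-periodic E-per h-per 1 (suc d)) Q) ⟩
      Q * q * ⌊ suc d /2⌋ + Q * q * ⌈ suc d /2⌉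
        ≡⟨ *-distribˡ-+ (Q * q) ⌊ suc d /2⌋ ⌈ suc d /2⌉ ⟨
      Q * q * (⌊ suc d /2⌋ + ⌈ suc d /2⌉)
        ≡⟨ cong (Q * q *_) (⌊n/2⌋+⌈n/2⌉≡n (suc d)) ⟩
      Q * q * suc d ∎
      where
      open ≤-Reasoning
      open ℤ.+-*-Solver using (solve; _:+_; _:-_; _:*_; _:=_)
      N : ℕ
      N = 2 ^ k * (Q * q)
      a b A B : ℤ
      a = corr (lift 0 (suc d) h) ⌊ suc d /2⌋ N
      b = corr (lift 1 (suc d) h) ⌈ suc d /2⌉ N
      A = main k ⌊ suc d /2⌋ (lift 0 (suc d) h)
      B = main k ⌈ suc d /2⌉ (lift 1 (suc d) h)
      double : 2 ^ suc k * (Q * q) ≡ N + N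
      double = trans (cong (_* (Q * q)) (2^suc k)) (*-distribʳ-+ (Q * q) (2 ^ k) (2 ^ k))
      ⌈N+N/2⌉ : ⌈ N + N /2⌉ ≡ N
      ⌈N+N/2⌉ = +-cancelˡ-≡ ⌊ N + N /2⌋ _ _
        (trans (⌊n/2⌋+⌈n/2⌉≡n (N + N)) (cong (_+ N) (n≡⌊n+n/2⌋ N)))
      halves : corr h (suc d) (2 ^ suc k * (Q * q)) ≡ a ℤ.+ b
      halves = trans (corr-split h (suc d) (2 ^ suc k * (Q * q))) (cong₂ ℤ._+_
        (cong (corr (lift 0 (suc d) h) ⌊ suc d /2⌋) (trans (cong ⌈_/2⌉ double) ⌈N+N/2⌉))
        (cong (corr (lift 1 (suc d) h) ⌈ suc d /2⌉) (trans (cong ⌊_/2⌋ double) (sym (n≡⌊n+n/2⌋ N)))))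

    -- If the main term exceeded `q * d`, it would beat the error by at least 1 per block, so the
    -- sum over `Q` blocks would be at least `Q` in absolute value: a fixed positive proportion of
    -- the number of terms.
    negligible⇒main-small : ∀ d →
      (∀ k → ∃ λ N₀ → ∀ N → N₀ ≤ N → ∣ corr (λ _ → false) d N ∣ * suc k ≤ N) →
      ∀ k → ∣ main k d (λ _ → false) ∣ ≤ q * d
    negligible⇒main-small d small k = ≮⇒≥ λ qd<∣D∣ → <-irrefl refl (begin-strict
      Q * K                                        <⟨ m<n+m (Q * K) {Q} (s≤s z≤n) ⟩
      Q + Q * K                                    ≡⟨ *-suc Q K ⟨
      Q * suc K                                    ≤⟨ *-monoˡ-≤ (suc K) (Q≤∣x∣ qd<∣D∣) ⟩
      ∣ x ∣ * suc K                                ≤⟨ proj₂ (small K) N N₀≤N ⟩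
      2 ^ k * (Q * q)
        ≡⟨ solve 3 (λ a b c → a :* (b :* c) := b :* (a :* c)) refl (2 ^ k) Q q ⟩
      Q * K                                        ∎)
      where
      open ≤-Reasoning
      open +-*-Solver
      K Q N : ℕ
      -- `K` is the length of a block, so `N` equals `Q * K`, while negligibility at `K` bounds the
      -- sum times `suc K` by `N`. `Q` is taken large enough for `N` to pass the threshold.
      K = 2 ^ k * q
      Q = suc (proj₁ (small K))
      N = 2 ^ k * (Q * q)
      D x : ℤ
      D = main k d (λ _ → false)
      x = corr (λ _ → false) d N
      N₀≤N : proj₁ (small K) ≤ N
      N₀≤N = ≤-trans (n≤1+n _) (≤-trans (m≤m*n Q q) (m≤n*m (Q * q) (2 ^ k) {{m^n≢0 2 k}}))
      Q≤∣x∣ : q * d < ∣ D ∣ → Q ≤ ∣ x ∣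
      Q≤∣x∣ qd<∣D∣ = +-cancelˡ-≤ (Q * (q * d)) _ _ (begin
        Q * (q * d) + Q                           ≡⟨ trans (*-suc Q (q * d)) (+-comm Q _) ⟨
        Q * suc (q * d)                           ≤⟨ *-monoʳ-≤ Q qd<∣D∣ ⟩
        Q * ∣ D ∣                                 ≡⟨ ℤ.abs-* (pos Q) D ⟨
        ∣ pos Q ℤ.* D ∣
          ≡⟨ cong ∣_∣ (ZS.solve 2 (λ y x → y ZS.:= x ZS.:- (x ZS.:- y)) refl (pos Q ℤ.* D) x) ⟩
        ∣ x ℤ.- (x ℤ.- pos Q ℤ.* D) ∣               ≤⟨ ℤ.∣i-j∣≤∣i∣+∣j∣ x _ ⟩
        ∣ x ∣ + ∣ x ℤ.- pos Q ℤ.* D ∣               ≤⟨ +-monoʳ-≤ ∣ x ∣ (corr-approx k d (λ _ → refl) Q) ⟩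
        ∣ x ∣ + Q * q * d                         ≡⟨ trans (+-comm ∣ x ∣ _) (cong (_+ ∣ x ∣) (*-assoc Q q d)) ⟩
        Q * (q * d) + ∣ x ∣                       ∎)
        where module ZS = ℤ.+-*-Solver

-- Words and digits

_≟ᵂ_ : DecidableEquality Word
_≟ᵂ_ = ≡-dec Bool._≟_

_≡ᵂ_ : Word → Word → Bool
v ≡ᵂ w = does (v ≟ᵂ w)

bitEq≡does : ∀ x y → bitEq x y ≡ does (x Bool.≟ y)
bitEq≡does true  true  = refl
bitEq≡does true  false = refl
bitEq≡does false true  = refl
bitEq≡does false false = refl

-- A prefix of the extended word is either the whole word or a prefix of `w`, and never both.
isPrefix-∷ʳ : ∀ v w c → b2n (isPrefix v (w ++ c ∷ [])) ≡ b2n (v ≡ᵂ (w ++ c ∷ [])) + b2n (isPrefix v w)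
isPrefix-∷ʳ []          []      c = refl
isPrefix-∷ʳ []          (y ∷ w) c = refl
isPrefix-∷ʳ (x ∷ [])    []      c rewrite bitEq≡does x c = sym (+-identityʳ _)
isPrefix-∷ʳ (x ∷ _ ∷ _) []      c rewrite ∧-zeroʳ (bitEq x c) | ∧-zeroʳ (does (x Bool.≟ c)) = refl
isPrefix-∷ʳ (x ∷ v)     (y ∷ w) c rewrite bitEq≡does x y with does (x Bool.≟ y)
... | true  = isPrefix-∷ʳ v w c
... | false = refl

reverse-≡ᵂ : ∀ v w → (reverse v ≡ᵂ w) ≡ (v ≡ᵂ reverse w)
reverse-≡ᵂ v w = does-⇔ (mk⇔
  (λ eq → trans (sym (reverse-involutive v)) (cong reverse eq))
  (λ eq → trans (cong reverse eq) (reverse-involutive w)))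
  (reverse v ≟ᵂ w) (v ≟ᵂ reverse w)

-- `occ` recurses on the first letter, whereas the recursion on `n` removes the last digit. The only
-- new occurrence after appending `c` is a suffix, expressed as a prefix of the reversed word.
occ-∷ʳ : ∀ x v w c → let u = x ∷ v in
  occ u (w ++ c ∷ []) ≡ b2n (isPrefix (reverse u) (reverse (w ++ c ∷ []))) + occ u w
occ-∷ʳ x v [] c = cong (_+ 0) (begin
  b2n (isPrefix u (c ∷ []))                                        ≡⟨ isPrefix-∷ʳ u [] c ⟩
  b2n (u ≡ᵂ (c ∷ [])) + 0                                          ≡⟨ cong₂ (λ a b → b2n a + b2n b)
                                                                        (reverse-≡ᵂ u (c ∷ [])) not-empty ⟨
  b2n (reverse u ≡ᵂ (c ∷ [])) + b2n (isPrefix (reverse u) [])      ≡⟨ isPrefix-∷ʳ (reverse u) [] c ⟨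
  b2n (isPrefix (reverse u) (c ∷ []))                              ∎)
  where
  open ≡-Reasoning
  u : Word
  u = x ∷ v
  ∷ʳ-not-empty : ∀ w → isPrefix (w ++ x ∷ []) [] ≡ false
  ∷ʳ-not-empty []      = refl
  ∷ʳ-not-empty (_ ∷ _) = refl
  not-empty : isPrefix (reverse u) [] ≡ false
  not-empty = trans (cong (λ r → isPrefix r []) (unfold-reverse x v)) (∷ʳ-not-empty (reverse v))
occ-∷ʳ x v (y ∷ w) c = begin
  b2n (isPrefix u (y ∷ w′)) + occ u w′
    ≡⟨ cong₂ _+_ (isPrefix-∷ʳ u (y ∷ w) c) (occ-∷ʳ x v w c) ⟩
  (b2n (u ≡ᵂ (y ∷ w′)) + b2n (isPrefix u (y ∷ w))) + (b2n (isPrefix (reverse u) (reverse w′)) + occ u w)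
    ≡⟨ solve 4 (λ a b c d → (a :+ b) :+ (c :+ d) := (a :+ c) :+ (b :+ d))
         refl (b2n (u ≡ᵂ (y ∷ w′))) _ _ (occ u w) ⟩
  (b2n (u ≡ᵂ (y ∷ w′)) + b2n (isPrefix (reverse u) (reverse w′))) + (b2n (isPrefix u (y ∷ w)) + occ u w)
    ≡⟨ cong (_+ occ u (y ∷ w)) last-letter ⟨
  b2n (isPrefix (reverse u) (reverse (y ∷ w′))) + occ u (y ∷ w) ∎
  where
  open ≡-Reasoning
  open +-*-Solver
  u w′ : Word
  u = x ∷ v
  w′ = w ++ c ∷ []
  last-letter : b2n (isPrefix (reverse u) (reverse (y ∷ w′))) ≡
    b2n (u ≡ᵂ (y ∷ w′)) + b2n (isPrefix (reverse u) (reverse w′))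
  last-letter = begin
    b2n (isPrefix (reverse u) (reverse (y ∷ w′)))
      ≡⟨ cong (λ r → b2n (isPrefix (reverse u) r)) (unfold-reverse y w′) ⟩
    b2n (isPrefix (reverse u) (reverse w′ ++ y ∷ []))
      ≡⟨ isPrefix-∷ʳ (reverse u) (reverse w′) y ⟩
    b2n (reverse u ≡ᵂ (reverse w′ ++ y ∷ [])) + b2n (isPrefix (reverse u) (reverse w′))
      ≡⟨ cong (λ b → b2n b + b2n (isPrefix (reverse u) (reverse w′))) (begin
           (reverse u ≡ᵂ (reverse w′ ++ y ∷ []))  ≡⟨ cong (reverse u ≡ᵂ_) (unfold-reverse y w′) ⟨
           (reverse u ≡ᵂ reverse (y ∷ w′))        ≡⟨ reverse-≡ᵂ u (reverse (y ∷ w′)) ⟩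
           (u ≡ᵂ reverse (reverse (y ∷ w′)))      ≡⟨ cong (u ≡ᵂ_) (reverse-involutive (y ∷ w′)) ⟩
           (u ≡ᵂ (y ∷ w′))                        ∎) ⟩
    b2n (u ≡ᵂ (y ∷ w′)) + b2n (isPrefix (reverse u) (reverse w′)) ∎

n/2≡⌊n/2⌋ : ∀ n → n / 2 ≡ ⌊ n /2⌋
n/2≡⌊n/2⌋ zero          = refl
n/2≡⌊n/2⌋ (suc zero)    = refl
n/2≡⌊n/2⌋ (suc (suc n)) = trans (+-distrib-/-∣ˡ {2} n ∣-refl) (cong suc (n/2≡⌊n/2⌋ n))

isOdd≡odd : ∀ n → isOdd n ≡ odd n
isOdd≡odd zero          = refl
isOdd≡odd (suc zero)    = refl
isOdd≡odd (suc (suc n)) = trans (isOdd≡odd n) (sym (not-involutive (odd n)))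

binFuel-enough : ∀ f g n → n ≤ f → n ≤ g → binFuel f n ≡ binFuel g n
binFuel-enough zero    zero    n       _   _   = refl
binFuel-enough zero    (suc g) .zero   z≤n _   = refl
binFuel-enough (suc f) zero    .zero   _   z≤n = refl
binFuel-enough (suc f) (suc g) zero    _   _   = refl
binFuel-enough (suc f) (suc g) (suc n) (s≤s n≤f) (s≤s n≤g) =
  cong (_++ _) (binFuel-enough f g (suc n / 2) (≤-trans half≤n n≤f) (≤-trans half≤n n≤g))
  where
  half≤n : suc n / 2 ≤ n
  half≤n = subst (_≤ n) (sym (n/2≡⌊n/2⌋ (suc n))) (≤-pred (⌊n/2⌋<n n))

bin-suc : ∀ n → bin (suc n) ≡ bin ⌊ suc n /2⌋ ++ odd (suc n) ∷ []
bin-suc n = cong₂ (λ w b → w ++ b ∷ [])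
  (trans (cong (binFuel n) (n/2≡⌊n/2⌋ (suc n))) (binFuel-enough n _ _ (≤-pred (⌊n/2⌋<n n)) ≤-refl))
  (isOdd≡odd (suc n))

-- Here and in low, words are read with the least significant digit first.
match : Word → ℕ → Bool
match []      n = true
match (b ∷ r) n = bitEq b (odd n) ∧ match r ⌊ n /2⌋

reverse-bin-suc : ∀ n → reverse (bin (suc n)) ≡ odd (suc n) ∷ reverse (bin ⌊ suc n /2⌋)
reverse-bin-suc n = trans (cong reverse (bin-suc n)) (reverse-++ (bin ⌊ suc n /2⌋) _)

-- Beyond the leading digit of `n`, `match` reads zeros where the expansion has ended. The most
-- significant letter of `r` is 1, so both tests fail if `r` reaches that far.
isPrefix≡match : ∀ r n → lastW r ≡ just true → isPrefix r (reverse (bin n)) ≡ match r n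
isPrefix≡match (true ∷ [])  zero    _    = refl
isPrefix≡match (b ∷ [])     (suc n) _    rewrite reverse-bin-suc n = refl
isPrefix≡match (b ∷ c ∷ r)  zero    last =
  sym (trans (cong (bitEq b false ∧_) (sym (isPrefix≡match (c ∷ r) zero last))) (∧-zeroʳ _))
isPrefix≡match (b ∷ c ∷ r)  (suc n) last = trans (cong (isPrefix (b ∷ c ∷ r)) (reverse-bin-suc n))
  (cong (bitEq b (odd (suc n)) ∧_) (isPrefix≡match (c ∷ r) ⌊ suc n /2⌋ last))

lastW-∷ʳ : ∀ w c → lastW (w ++ c ∷ []) ≡ just c
lastW-∷ʳ []          c = refl
lastW-∷ʳ (x ∷ [])    c = refl
lastW-∷ʳ (x ∷ y ∷ w) c = lastW-∷ʳ (y ∷ w) c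

lastW-reverse : ∀ v → lastW (reverse v) ≡ headW v
lastW-reverse []      = refl
lastW-reverse (x ∷ v) = trans (cong lastW (unfold-reverse x v)) (lastW-∷ʳ (reverse v) x)

headW-reverse : ∀ v → headW (reverse v) ≡ lastW v
headW-reverse v = trans (sym (lastW-reverse (reverse v))) (cong lastW (reverse-involutive v))

occ-leading-zeros : ∀ v k w → occ (true ∷ v) (replicate k false ++ w) ≡ occ (true ∷ v) w
occ-leading-zeros v zero    w = refl
occ-leading-zeros v (suc k) w = occ-leading-zeros v k w

-- Since `v` begins with 1, no occurrence starts in the zero padding. Those in the expansion of `n`
-- either end at its last digit or lie in the expansion of `⌊ n /2⌋`.
count#-rec : ∀ v n → headW v ≡ just true →
  count# v n ≡ b2n (match (reverse v) n) + count# v ⌊ n /2⌋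
count#-rec v@(true ∷ v′) n refl = begin
  count# v n                                         ≡⟨ occ-leading-zeros v′ (length v′) (bin n) ⟩
  occ v (bin n)                                      ≡⟨ digits n ⟩
  b2n (match (reverse v) n) + occ v (bin ⌊ n /2⌋)
    ≡⟨ cong (b2n (match (reverse v) n) +_) (occ-leading-zeros v′ (length v′) (bin ⌊ n /2⌋)) ⟨
  b2n (match (reverse v) n) + count# v ⌊ n /2⌋       ∎
  where
  open ≡-Reasoning
  matches : ∀ n → isPrefix (reverse v) (reverse (bin n)) ≡ match (reverse v) n
  matches n = isPrefix≡match (reverse v) n (lastW-reverse v)
  -- 0 is its own half, so the recursion at 0 requires that `v`, which contains a 1, does not match
  -- there.
  no-match-0 : match (reverse v) 0 ≡ false
  no-match-0 = trans (sym (matches 0)) (not-prefix (reverse v) (lastW-reverse v))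
    where
    not-prefix : ∀ r → lastW r ≡ just true → isPrefix r [] ≡ false
    not-prefix (_ ∷ _) _ = refl
  digits : ∀ n → occ v (bin n) ≡ b2n (match (reverse v) n) + occ v (bin ⌊ n /2⌋)
  digits zero    rewrite no-match-0 = refl
  digits (suc n) = begin
    occ v (bin (suc n))
      ≡⟨ cong (occ v) (bin-suc n) ⟩
    occ v (bin ⌊ suc n /2⌋ ++ odd (suc n) ∷ [])
      ≡⟨ occ-∷ʳ true v′ (bin ⌊ suc n /2⌋) (odd (suc n)) ⟩
    b2n (isPrefix (reverse v) (reverse (bin ⌊ suc n /2⌋ ++ odd (suc n) ∷ []))) + occ v (bin ⌊ suc n /2⌋)
      ≡⟨ cong (λ w → b2n (isPrefix (reverse v) (reverse w)) + occ v (bin ⌊ suc n /2⌋)) (bin-suc n) ⟨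
    b2n (isPrefix (reverse v) (reverse (bin (suc n)))) + occ v (bin ⌊ suc n /2⌋)
      ≡⟨ cong (λ b → b2n b + occ v (bin ⌊ suc n /2⌋)) (matches (suc n)) ⟩
    b2n (match (reverse v) (suc n)) + occ v (bin ⌊ suc n /2⌋) ∎

-- Parity of the occurrence counts and its increments

⨁ : (Word → Bool) → List Word → Bool
⨁ f = foldr (λ v b → f v xor b) false

⨁-cong : ∀ {f g A} → All (λ v → f v ≡ g v) A → ⨁ f A ≡ ⨁ g A
⨁-cong []         = refl
⨁-cong (eq ∷ eqs) = cong₂ _xor_ eq (⨁-cong eqs)

⨁-xor : ∀ f g A → ⨁ (λ v → f v xor g v) A ≡ ⨁ f A xor ⨁ g A
⨁-xor f g []      = refl
⨁-xor f g (v ∷ A) = trans (cong ((f v xor g v) xor_) (⨁-xor f g A))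
  (solve 4 (λ a b c d → (a :+ b) :+ (c :+ d) := (a :+ c) :+ (b :+ d)) refl (f v) (g v) (⨁ f A) (⨁ g A))
  where open xor-∧-Solver

⨁-false : ∀ {f A} → All (λ v → f v ≡ false) A → ⨁ f A ≡ false
⨁-false []         = refl
⨁-false (eq ∷ eqs) = cong₂ _xor_ eq (⨁-false eqs)

odd-b2n : ∀ b → odd (b2n b) ≡ b
odd-b2n true  = refl
odd-b2n false = refl

-- These are the sequences s and E of the recursion, both modulo 2.
parity increment : List Word → ℕ → Bool
parity A n = isOdd (sumCounts A n)
increment A n = ⨁ (λ v → match (reverse v) n) A

parity≡⨁ : ∀ A n → parity A n ≡ ⨁ (λ v → odd (count# v n)) A
parity≡⨁ A n = trans (isOdd≡odd (sumCounts A n)) (go A)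
  where
  go : ∀ A → odd (sumCounts A n) ≡ ⨁ (λ v → odd (count# v n)) A
  go []      = refl
  go (v ∷ A) = trans (odd-+ (count# v n) (sumCounts A n)) (cong (odd (count# v n) xor_) (go A))

parity-rec : ∀ {A} → All BeginsEndsWith1 A → ∀ n → parity A n ≡ increment A n xor parity A ⌊ n /2⌋
parity-rec {A} ends n = begin
  parity A n
    ≡⟨ parity≡⨁ A n ⟩
  ⨁ (λ v → odd (count# v n)) A
    ≡⟨ ⨁-cong (All.map (λ {v} (begins , _) → trans (cong odd (count#-rec v n begins))
         (trans (odd-+ (b2n (match (reverse v) n)) _) (cong (_xor odd (count# v ⌊ n /2⌋)) (odd-b2n (match (reverse v) n))))) ends) ⟩
  ⨁ (λ v → match (reverse v) n xor odd (count# v ⌊ n /2⌋)) A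
    ≡⟨ ⨁-xor (λ v → match (reverse v) n) (λ v → odd (count# v ⌊ n /2⌋)) A ⟩
  increment A n xor ⨁ (λ v → odd (count# v ⌊ n /2⌋)) A
    ≡⟨ cong (increment A n xor_) (parity≡⨁ A ⌊ n /2⌋) ⟨
  increment A n xor parity A ⌊ n /2⌋ ∎
  where open ≡-Reasoning

increment-even : ∀ {A} → All BeginsEndsWith1 A → ∀ n → odd n ≡ false → increment A n ≡ false
increment-even ends n even = ⨁-false (All.map (λ {v} (_ , last) → go (reverse v) (trans (headW-reverse v) last)) ends)
  where
  go : ∀ r → headW r ≡ just true → match r n ≡ false
  go (true ∷ r) refl rewrite even = refl

low : ℕ → ℕ → Word
low zero    x = []
low (suc j) x = odd x ∷ low j ⌊ x /2⌋

length-low : ∀ j x → length (low j x) ≡ j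
length-low zero    x = refl
length-low (suc j) x = cong suc (length-low j ⌊ x /2⌋)

-- Adding 2^j toggles digit j and keeps the digits below; carries go beyond the reach of `r`. The
-- outcome changes only if `r` has length j+1 and its lower j letters agree with `x`; then, as its
-- top letter is 1, exactly one of the two numbers matches.
match-flip : ∀ r j x → length r ≤ suc j → lastW r ≡ just true →
  match r (x + 2 ^ j) xor match r x ≡ (r ≡ᵂ (low j x ++ true ∷ []))
match-flip (true ∷ []) zero x _ refl
  rewrite +-comm x 1 with odd x
... | true  = refl
... | false = refl
match-flip (_ ∷ _ ∷ _) zero x (s≤s ()) _
match-flip (b ∷ r) (suc j) x (s≤s len) last
  rewrite 2^suc j | odd-+double x (2 ^ j)
        | trans (cong ⌊_/2⌋ (+-comm x (2 ^ j + 2 ^ j))) (⌊n+n+m/2⌋ (2 ^ j) x)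
        | +-comm (2 ^ j) ⌊ x /2⌋ | bitEq≡does b (odd x)
  with does (b Bool.≟ odd x)
... | false = refl
... | true with r
...   | [] = trans (xor-same true) (sym (empty j))
  where
  empty : ∀ j → ([] ≡ᵂ (low j ⌊ x /2⌋ ++ true ∷ [])) ≡ false
  empty zero    = refl
  empty (suc j) = refl
...   | c ∷ r′ = match-flip (c ∷ r′) j ⌊ x /2⌋ len last

-- The multiplicity modulo 2, which decides membership when `A` has no duplicates.
member : List Word → Word → Bool
member A w = ⨁ (_≡ᵂ w) A

∉⇒¬member : ∀ A w → w ∉ A → member A w ≡ false
∉⇒¬member []      w w∉A = refl
∉⇒¬member (v ∷ A) w w∉A = cong₂ _xor_
  (dec-false (v ≟ᵂ w) (λ v≡w → w∉A (here (sym v≡w)))) (∉⇒¬member A w (λ w∈A → w∉A (there w∈A)))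

∈⇒member : ∀ {A w} → Unique A → w ∈ A → member A w ≡ true
∈⇒member {v ∷ A} {w} (v∉A ∷ _) (here refl) = cong₂ _xor_ (dec-true (w ≟ᵂ w) refl)
  (⨁-false (All.map (λ {u} w≢u → dec-false (u ≟ᵂ w) (λ u≡w → w≢u (sym u≡w))) v∉A))
∈⇒member {v ∷ A} {w} (v∉A ∷ uniq) (there w∈A) = cong₂ _xor_
  (dec-false (v ≟ᵂ w) (λ v≡w → All.lookup v∉A w∈A v≡w)) (∈⇒member uniq w∈A)

member⇒∈ : ∀ A w → member A w ≡ true → w ∈ A
member⇒∈ (v ∷ A) w mem with v ≟ᵂ w
... | yes v≡w = here (sym v≡w)
... | no  _   = there (member⇒∈ A w mem)

length≤maxLen : ∀ A → All (λ v → length v ≤ maxLen A) A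
length≤maxLen []      = []
length≤maxLen (v ∷ A) = m≤m⊔n (length v) (maxLen A) ∷
  All.map (λ le → ≤-trans le (m≤n⊔m (length v) (maxLen A))) (length≤maxLen A)

long⇒¬member : ∀ A w → maxLen A < length w → member A w ≡ false
long⇒¬member A w long = ∉⇒¬member A w (λ w∈A → <⇒≱ long (All.lookup (length≤maxLen A) w∈A))

-- `match-flip` summed over `A`. For j+1 = ℓ it tests a word of maximal length; for j+1 > ℓ that
-- word is too long to be in `A`, and 2^j is a period.
increment-flip : ∀ {A} → All BeginsEndsWith1 A → ∀ j → maxLen A ≤ suc j → ∀ x →
  increment A (x + 2 ^ j) xor increment A x ≡ member A (true ∷ reverse (low j x))
increment-flip {A} ends j len x = trans
  (sym (⨁-xor (λ v → match (reverse v) (x + 2 ^ j)) (λ v → match (reverse v) x) A)) (⨁-cong (All.zipWith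
  (λ {v} ((begins , _) , le) → begin
    match (reverse v) (x + 2 ^ j) xor match (reverse v) x
      ≡⟨ match-flip (reverse v) j x (≤-trans (≤-reflexive (length-reverse v)) (≤-trans le len))
           (trans (lastW-reverse v) begins) ⟩
    (reverse v ≡ᵂ (low j x ++ true ∷ []))
      ≡⟨ reverse-≡ᵂ v _ ⟩
    (v ≡ᵂ reverse (low j x ++ true ∷ []))
      ≡⟨ cong (v ≡ᵂ_) (reverse-++ (low j x) (true ∷ [])) ⟩
    (v ≡ᵂ (true ∷ reverse (low j x))) ∎)
  (ends , length≤maxLen A)))
  where open ≡-Reasoning

-- The finite check for ℓ ≤ 5

-- Polynomials in n signs modulo xᵢ² = 1. A point is given by the bits γᵢ with xᵢ = (-1)^γᵢ, so
-- the value of a monomial is the sign of a linear form ⟪ v ⟫ over GF(2).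
⟪_⟫ : ∀ {n} → Vec Bool n → Vec Bool n → Bool
⟪ []    ⟫ []      = false
⟪ b ∷ v ⟫ (c ∷ γ) = (b ∧ c) xor ⟪ v ⟫ γ

zeroV : ∀ {n} → Vec Bool n
zeroV = Vec.replicate _ false

unit : ∀ {n} → ℕ → Vec Bool n
unit {zero}  _       = []
unit {suc n} zero    = true ∷ zeroV
unit {suc n} (suc i) = false ∷ unit i

_⊕_ : ∀ {n} → Vec Bool n → Vec Bool n → Vec Bool n
_⊕_ = Vec.zipWith _xor_

⟪zeroV⟫ : ∀ {n} (γ : Vec Bool n) → ⟪ zeroV ⟫ γ ≡ false
⟪zeroV⟫ []      = refl
⟪zeroV⟫ (b ∷ γ) = ⟪zeroV⟫ γ

⟪⊕⟫ : ∀ {n} (v w γ : Vec Bool n) → ⟪ v ⊕ w ⟫ γ ≡ ⟪ v ⟫ γ xor ⟪ w ⟫ γ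
⟪⊕⟫ []      []      []      = refl
⟪⊕⟫ (a ∷ v) (b ∷ w) (c ∷ γ) rewrite ⟪⊕⟫ v w γ =
  solve 5 (λ a b c x y → (a :+ b) :* c :+ (x :+ y) := (a :* c :+ x) :+ (b :* c :+ y)) refl a b c (⟪ v ⟫ γ) (⟪ w ⟫ γ)
  where open xor-∧-Solver

table : ∀ n → (ℕ → Bool) → Vec Bool n
table zero    f = []
table (suc n) f = f 0 ∷ table n (λ i → f (suc i))

_!_ : ∀ {n} → Vec Bool n → ℕ → Bool
[]      ! _     = false
(b ∷ v) ! zero  = b
(b ∷ v) ! suc i = v ! i

table-! : ∀ n f i → i < n → table n f ! i ≡ f i
table-! (suc n) f zero    _         = refl
table-! (suc n) f (suc i) (s≤s i<n) = table-! n (λ i → f (suc i)) i i<n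

⟪unit⟫ : ∀ {n} i (γ : Vec Bool n) → ⟪ unit i ⟫ γ ≡ γ ! i
⟪unit⟫ i       []      = refl
⟪unit⟫ zero    (b ∷ γ) = trans (cong (b xor_) (⟪zeroV⟫ γ)) (xor-identityʳ b)
⟪unit⟫ (suc i) (b ∷ γ) = ⟪unit⟫ i γ

-- `p +X· q` stands for p + x q, where x is the first sign and `p`, `q` involve the others; no
-- higher power is needed as x² = 1. `zeroP` at every arity leaves absent branches unexpanded.
data Poly : ℕ → Set where
  zeroP : ∀ {n} → Poly n
  const : ℤ → Poly 0
  _+X·_ : ∀ {n} → Poly n → Poly n → Poly (suc n)

eval : ∀ {n} → Poly n → Vec Bool n → ℤ
eval zeroP     γ       = 0ℤ
eval (const c) []      = c
eval (p +X· q) (b ∷ γ) = eval p γ ℤ.+ sgn b ℤ.* eval q γ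

addMonomial : ∀ {n} → ℤ → Vec Bool n → Poly n → Poly n
addMonomial c []          zeroP     = const c
addMonomial c []          (const d) = const (c ℤ.+ d)
addMonomial c (false ∷ v) zeroP     = addMonomial c v zeroP +X· zeroP
addMonomial c (true  ∷ v) zeroP     = zeroP +X· addMonomial c v zeroP
addMonomial c (false ∷ v) (p +X· q) = addMonomial c v p +X· q
addMonomial c (true  ∷ v) (p +X· q) = p +X· addMonomial c v q

eval-addMonomial : ∀ {n} c v (p : Poly n) γ →
  eval (addMonomial c v p) γ ≡ c ℤ.* sgn (⟪ v ⟫ γ) ℤ.+ eval p γ
eval-addMonomial c [] zeroP     [] = solve 1 (λ c → c := c :* con 1ℤ :+ con 0ℤ) refl c
  where open ℤ.+-*-Solver
eval-addMonomial c [] (const d) [] = solve 2 (λ c d → c :+ d := c :* con 1ℤ :+ d) refl c d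
  where open ℤ.+-*-Solver
eval-addMonomial c (false ∷ v) zeroP (b ∷ γ) rewrite eval-addMonomial c v zeroP γ =
  solve 3 (λ c s b → c :* s :+ con 0ℤ :+ b :* con 0ℤ := c :* s :+ con 0ℤ) refl c (sgn (⟪ v ⟫ γ)) (sgn b)
  where open ℤ.+-*-Solver
eval-addMonomial c (true ∷ v) zeroP (b ∷ γ) rewrite eval-addMonomial c v zeroP γ | sgn-xor b (⟪ v ⟫ γ) =
  solve 3 (λ c s b → con 0ℤ :+ b :* (c :* s :+ con 0ℤ) := c :* (b :* s) :+ con 0ℤ) refl c (sgn (⟪ v ⟫ γ)) (sgn b)
  where open ℤ.+-*-Solver
eval-addMonomial c (false ∷ v) (p +X· q) (b ∷ γ) rewrite eval-addMonomial c v p γ =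
  ℤ.+-assoc (c ℤ.* sgn (⟪ v ⟫ γ)) (eval p γ) _
eval-addMonomial c (true ∷ v) (p +X· q) (b ∷ γ) rewrite eval-addMonomial c v q γ | sgn-xor b (⟪ v ⟫ γ) =
  solve 5 (λ c s b p q → p :+ b :* (c :* s :+ q) := c :* (b :* s) :+ (p :+ b :* q)) refl
    c (sgn (⟪ v ⟫ γ)) (sgn b) (eval p γ) (eval q γ)
  where open ℤ.+-*-Solver

addSigned : ∀ {n} → Bool → Poly n → Poly n → Poly n
addSigned b p         zeroP       = p
addSigned b zeroP     (const d)   = const (sgn b ℤ.* d)
addSigned b zeroP     (p′ +X· q′) = addSigned b zeroP p′ +X· addSigned b zeroP q′
addSigned b (const c) (const d)   = const (c ℤ.+ sgn b ℤ.* d)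
addSigned b (p +X· q) (p′ +X· q′) = addSigned b p p′ +X· addSigned b q q′

eval-addSigned : ∀ {n} b (p q : Poly n) γ → eval (addSigned b p q) γ ≡ eval p γ ℤ.+ sgn b ℤ.* eval q γ
eval-addSigned b p zeroP γ = trans (sym (ℤ.+-identityʳ (eval p γ)))
  (cong (λ z → eval p γ ℤ.+ z) (sym (ℤ.*-zeroʳ (sgn b))))
eval-addSigned b zeroP     (const d) [] = sym (ℤ.+-identityˡ _)
eval-addSigned b (const c) (const d) [] = refl
eval-addSigned b zeroP (p′ +X· q′) (a ∷ γ)
  rewrite eval-addSigned b zeroP p′ γ | eval-addSigned b zeroP q′ γ =
  solve 4 (λ b a p q → (con 0ℤ :+ b :* p) :+ a :* (con 0ℤ :+ b :* q) := con 0ℤ :+ b :* (p :+ a :* q)) refl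
    (sgn b) (sgn a) (eval p′ γ) (eval q′ γ)
  where open ℤ.+-*-Solver
eval-addSigned b (p +X· q) (p′ +X· q′) (a ∷ γ)
  rewrite eval-addSigned b p p′ γ | eval-addSigned b q q′ γ =
  solve 6 (λ b a p q p′ q′ → (p :+ b :* p′) :+ a :* (q :+ b :* q′) := (p :+ a :* q) :+ b :* (p′ :+ a :* q′)) refl
    (sgn b) (sgn a) (eval p γ) (eval q γ) (eval p′ γ) (eval q′ γ)
  where open ℤ.+-*-Solver

restrict : ∀ {n} → Bool → Poly (suc n) → Poly n
restrict b zeroP     = zeroP
restrict b (p +X· q) = addSigned b p q

eval-restrict : ∀ {n} b (p : Poly (suc n)) γ → eval (restrict b p) γ ≡ eval p (b ∷ γ)
eval-restrict b zeroP     γ = refl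
eval-restrict b (p +X· q) γ = eval-addSigned b p q γ

-- Decides whether at every point `φ` holds or some polynomial exceeds its threshold in absolute
-- value. Points with a common beginning share the work of restriction.
check : ∀ n → List (ℕ × Poly n) → (Vec Bool n → Bool) → Bool
check zero    []             φ = φ []
check zero    ((t , p) ∷ ps) φ = (t <ᵇ ∣ eval p [] ∣) ∨ check zero ps φ
check (suc n) ps             φ = branch false ∧ branch true
  where
  branch : Bool → Bool
  branch b = check n (List.map (λ (t , p) → t , restrict b p) ps) (λ γ → φ (b ∷ γ))

check-sound : ∀ n ps φ → check n ps φ ≡ true →
  ∀ γ → All (λ (t , p) → ∣ eval p γ ∣ ≤ t) ps → φ γ ≡ true
check-sound zero []             φ ok [] []             = ok
check-sound zero ((t , p) ∷ ps) φ ok [] (small ∷ smalls) with t <ᵇ ∣ eval p [] ∣ in eq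
... | true  = contradiction small (<⇒≱ (<ᵇ⇒< t _ (subst T (sym eq) tt)))
... | false = check-sound zero ps φ ok [] smalls
check-sound (suc n) ps φ ok (b ∷ γ) smalls = check-sound n _ _ (branch b) γ
  (map⁺ (All.map (λ {(t , p)} → ≤-trans (≤-reflexive (cong ∣_∣ (eval-restrict b p γ)))) smalls))
  where
  branch : ∀ b → check n (List.map (λ (t , p) → t , restrict b p) ps) (λ γ → φ (b ∷ γ)) ≡ true
  branch false = Bool.∧-conicalˡ _ _ ok
  branch true  = Bool.∧-conicalʳ _ _ ok

-- The unknowns are the increments at 1, 3, …, 31; these determine all increments when ℓ ≤ 5.
incrementV : ℕ → Vec Bool 16
incrementV n = if odd (n % 32) then unit ⌊ n % 32 /2⌋ else zeroV

liftV : ℕ → ℕ → (ℕ → Vec Bool 16) → ℕ → Vec Bool 16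
liftV δ d h n = h (δ + (n + n)) ⊕ (incrementV (δ + (n + n)) ⊕ incrementV (δ + (n + n) + d))

addSum : ℤ → ℕ → (ℕ → Vec Bool 16) → Poly 16 → Poly 16
addSum c zero    h p = p
addSum c (suc n) h p = addMonomial c (h n) (addSum c n h p)

-- The recursion of `main` for q = 16, with linear forms as weights; the accumulator `p` allows
-- monomials to be inserted one at a time.
addMain : ℕ → ℕ → (ℕ → Vec Bool 16) → Poly 16 → Poly 16
addMain k       zero    h p = addSum (pos (2 ^ k)) 16 h p
addMain zero    (suc d) h p = p
addMain (suc k) (suc d) h p =
  addMain k ⌊ suc d /2⌋ (liftV 0 (suc d) h) (addMain k ⌈ suc d /2⌉ (liftV 1 (suc d) h) p)

-- The threshold `16 * d` is the bound `q * d` of `negligible⇒main-small`.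
someMainLarge : ℕ → List ℕ → (Vec Bool 16 → Bool) → Bool
someMainLarge k ds = check 16 (List.map (λ d → 16 * d , addMain k d (λ _ → zeroV) zeroP) ds)

jumps : (Bool → Bool) → (ℕ → Bool) → ℕ → ℕ → Bool
jumps φ f k zero    = true
jumps φ f k (suc n) = φ (f (n + 2 ^ k) xor f n) ∧ jumps φ f k n

-- If f i is the increment at the odd number 2 i + 1, then f (i + 2 ^ k) xor f i tells whether A
-- contains the word 1 (i)₂ 1 with i written in k digits, provided that A has no longer word.
longest-full : ℕ → (ℕ → Bool) → Bool
longest-full zero    f = true
longest-full (suc k) f = jumps (λ b → b) f k (2 ^ k) ∨ (jumps not f k (2 ^ k) ∧ longest-full k f)

-- Depth 4 starts with the words 1u1 of length 5. The value `true` at depth 0 exempts the sets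
-- without words of length at least 2.
longestFull : Vec Bool 16 → Bool
longestFull γ = longest-full 4 (γ !_)

-- The depth 8 and the distances up to 7 were found by a search over all 2¹⁶ sets A.
distances : List ℕ
distances = 1 ∷ 2 ∷ 3 ∷ 4 ∷ 5 ∷ 6 ∷ 7 ∷ []

-- Established by evaluation: type checking `refl` computes the seven polynomials and runs through
-- their restrictions.
some-main-large : someMainLarge 8 distances longestFull ≡ true
some-main-large = refl

-- Soundness of the finite check

jumps-sound : ∀ φ f k n → jumps φ f k n ≡ true → ∀ i → i < n → φ (f (i + 2 ^ k) xor f i) ≡ true
jumps-sound φ f k (suc n) ok i i<1+n with m<1+n⇒m<n∨m≡n i<1+n
... | inj₁ i<n  = jumps-sound φ f k n (Bool.∧-conicalʳ _ _ ok) i i<n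
... | inj₂ refl = Bool.∧-conicalˡ _ _ ok

odd-half : ∀ n → odd n ≡ true → n ≡ suc (⌊ n /2⌋ + ⌊ n /2⌋)
odd-half (suc zero)    _  = refl
odd-half (suc (suc n)) eq = cong (λ k → suc (suc k))
  (trans (odd-half n (trans (sym (not-involutive (odd n))) eq)) (sym (+-suc ⌊ n /2⌋ ⌊ n /2⌋)))

half<16 : ∀ y → y < 32 → ⌊ y /2⌋ < 16
half<16 y (s≤s y≤31) = s≤s (⌊n/2⌋-mono y≤31)

module _ (s E : ℕ → Bool) (s-rec : ∀ n → s n ≡ E n xor s ⌊ n /2⌋)
  (E-even : ∀ n → odd n ≡ false → E n ≡ false) (E-per : Periodic 32 E) where

  open Correlations s E s-rec
  open CorrelationBounds s E s-rec
  open BlockSums 16 E-per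

  γ : Vec Bool 16
  γ = table 16 (λ i → E (suc (i + i)))

  -- Period 32 reduces `n` to its remainder. An even remainder gives `false` on both sides; an odd
  -- one is 2i+1 with i < 16, an entry of the table.
  ⟪incrementV⟫ : ∀ n → ⟪ incrementV n ⟫ γ ≡ E n
  ⟪incrementV⟫ n = trans digit (trans (sym (reduce (n / 32) (n % 32))) (cong E (sym (m≡m%n+[m/n]*n n 32))))
    where
    reduce : ∀ m r → E (r + m * 32) ≡ E r
    reduce zero    r = cong E (+-identityʳ r)
    reduce (suc m) r = trans (cong E (trans (cong (r +_) (+-comm 32 (m * 32))) (sym (+-assoc r (m * 32) 32))))
      (trans (E-per (r + m * 32)) (reduce m r))
    digit : ⟪ incrementV n ⟫ γ ≡ E (n % 32)
    digit with odd (n % 32) in eq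
    ... | false = trans (⟪zeroV⟫ γ) (sym (E-even (n % 32) eq))
    ... | true  = trans (⟪unit⟫ ⌊ n % 32 /2⌋ γ) (trans
      (table-! 16 (λ i → E (suc (i + i))) ⌊ n % 32 /2⌋ (half<16 (n % 32) (m%n<n n 32)))
      (cong E (sym (odd-half (n % 32) eq))))

  eval-addSum : ∀ c n {h g} p → (∀ i → ⟪ h i ⟫ γ ≡ g i) →
    eval (addSum c n h p) γ ≡ c ℤ.* Σ± g n ℤ.+ eval p γ
  eval-addSum c zero    p eq = sym (trans (cong (ℤ._+ eval p γ) (ℤ.*-zeroʳ c)) (ℤ.+-identityˡ _))
  eval-addSum c (suc n) {h} {g} p eq = begin
    eval (addMonomial c (h n) (addSum c n h p)) γ
      ≡⟨ eval-addMonomial c (h n) (addSum c n h p) γ ⟩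
    c ℤ.* sgn (⟪ h n ⟫ γ) ℤ.+ eval (addSum c n h p) γ
      ≡⟨ cong₂ (λ b z → c ℤ.* sgn b ℤ.+ z) (eq n) (eval-addSum c n {h} p eq) ⟩
    c ℤ.* sgn (g n) ℤ.+ (c ℤ.* Σ± g n ℤ.+ eval p γ)
      ≡⟨ solve 4 (λ c x y z → c :* x :+ (c :* y :+ z) := c :* (y :+ x) :+ z)
                                                                       refl c (sgn (g n)) (Σ± g n) (eval p γ) ⟩
    c ℤ.* Σ± g (suc n) ℤ.+ eval p γ                               ∎
    where
    open ≡-Reasoning
    open ℤ.+-*-Solver

  ⟪liftV⟫ : ∀ δ d {h g} → (∀ i → ⟪ h i ⟫ γ ≡ g i) → ∀ i → ⟪ liftV δ d h i ⟫ γ ≡ lift δ d g i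
  ⟪liftV⟫ δ d {h} eq i = trans (⟪⊕⟫ (h (δ + (i + i))) _ γ) (cong₂ _xor_ (eq _)
    (trans (⟪⊕⟫ (incrementV (δ + (i + i))) _ γ) (cong₂ _xor_ (⟪incrementV⟫ _) (⟪incrementV⟫ (δ + (i + i) + d)))))

  eval-addMain : ∀ k d {h g} p → (∀ i → ⟪ h i ⟫ γ ≡ g i) →
    eval (addMain k d h p) γ ≡ main k d g ℤ.+ eval p γ
  eval-addMain k       zero    {h} p eq = eval-addSum (pos (2 ^ k)) 16 {h} p eq
  eval-addMain zero    (suc d) p eq = sym (ℤ.+-identityˡ (eval p γ))
  eval-addMain (suc k) (suc d) {h} {g} p eq = begin
    eval (addMain k ⌊ suc d /2⌋ (liftV 0 (suc d) h) p′) γ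
      ≡⟨ eval-addMain k ⌊ suc d /2⌋ p′ (⟪liftV⟫ 0 (suc d) {h} eq) ⟩
    a ℤ.+ eval p′ γ
      ≡⟨ cong (λ z → a ℤ.+ z) (eval-addMain k ⌈ suc d /2⌉ p (⟪liftV⟫ 1 (suc d) {h} eq)) ⟩
    a ℤ.+ (main k ⌈ suc d /2⌉ (lift 1 (suc d) g) ℤ.+ eval p γ)
      ≡⟨ ℤ.+-assoc a _ _ ⟨
    main (suc k) (suc d) g ℤ.+ eval p γ ∎
    where
    open ≡-Reasoning
    a : ℤ
    a = main k ⌊ suc d /2⌋ (lift 0 (suc d) g)
    p′ : Poly 16
    p′ = addMain k ⌈ suc d /2⌉ (liftV 1 (suc d) h) p

  mains-small : ∀ k ds φ → someMainLarge k ds φ ≡ true →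
    All (λ d → ∣ main k d (λ _ → false) ∣ ≤ 16 * d) ds → φ γ ≡ true
  mains-small k ds φ ok smalls = check-sound 16 _ φ ok γ (map⁺ (All.map
    (λ {d} → ≤-trans (≤-reflexive (cong ∣_∣
      (trans (eval-addMain k d {λ _ → zeroV} {λ _ → false} zeroP (λ _ → ⟪zeroV⟫ γ)) (ℤ.+-identityʳ (main k d (λ _ → false)))))))
    smalls))

  negligible⇒longest-full :
    (∀ d → 1 ≤ d → ∀ k → ∃ λ N₀ → ∀ N → N₀ ≤ N → ∣ corr (λ _ → false) d N ∣ * suc k ≤ N) →
    longest-full 4 (γ !_) ≡ true
  negligible⇒longest-full negligible = mains-small 8 distances longestFull some-main-large
    (All.map (λ {d} 1≤d → negligible⇒main-small d (negligible d 1≤d) 8)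
      (s≤s z≤n ∷ s≤s z≤n ∷ s≤s z≤n ∷ s≤s z≤n ∷ s≤s z≤n ∷ s≤s z≤n ∷ s≤s z≤n ∷ []))

-- From indices back to words 1u1, and the theorem

val : Word → ℕ
val []          = 0
val (false ∷ w) = val w + val w
val (true  ∷ w) = suc (val w + val w)

-- `val` takes the least significant digit first, as `low` does.
low-val : ∀ w → low (length w) (val w) ≡ w
low-val []          = refl
low-val (false ∷ w) = cong₂ _∷_ (odd-+double 0 (val w))
  (trans (cong (low (length w)) (sym (n≡⌊n+n/2⌋ (val w)))) (low-val w))
low-val (true ∷ w) = cong₂ _∷_ (cong not (odd-+double 0 (val w)))
  (trans (cong (low (length w)) (⌊1+n+n/2⌋ (val w))) (low-val w))

val< : ∀ w → val w < 2 ^ length w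
val< []          = s≤s z≤n
val< (false ∷ w) = subst (val w + val w <_) (sym (2^suc (length w))) (+-mono-< (val< w) (val< w))
val< (true ∷ w)  = subst₂ _≤_ (cong suc (+-suc (val w) (val w))) (sym (2^suc (length w))) (+-mono-≤ (val< w) (val< w))

frame : Word → Word
frame u = true ∷ u ++ true ∷ []

length-frame : ∀ u → length (frame u) ≡ 2 + length u
length-frame u = cong suc (trans (length-++ u) (+-comm (length u) 1))

unframe : ∀ w → BeginsEndsWith1 w → 2 ≤ length w → ∃ λ u → w ≡ frame u
unframe (true ∷ x ∷ w) (refl , last) _ with init x w last
  where
  init : ∀ x w → lastW (x ∷ w) ≡ just true → ∃ λ u → x ∷ w ≡ u ++ true ∷ []
  init true []      refl = [] , refl
  init x    (y ∷ w) last with init y w last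
  ... | u , eq = x ∷ u , cong (x ∷_) eq
... | u , eq = u , cong (true ∷_) eq
unframe (_ ∷ []) _ (s≤s ())

-- This identifies `val (reverse u)` as the index of `frame u`: the final 1 is the last digit of the
-- odd number 2i+1, and the initial 1 is the digit toggled by the shift.
frame-low : ∀ u → true ∷ reverse (true ∷ low (length u) (val (reverse u))) ≡ frame u
frame-low u = cong (true ∷_) (trans (unfold-reverse true (low (length u) (val (reverse u))))
  (cong (_++ true ∷ []) (trans (cong reverse (trans
    (cong (λ k → low k (val (reverse u))) (sym (length-reverse u))) (low-val (reverse u))))
    (reverse-involutive u))))

longest : ∀ A → A ≢ [] → ∃ λ v → v ∈ A × length v ≡ maxLen A
longest []          A≢[] = contradiction refl A≢[]
longest (v ∷ [])    _    = v , here refl , sym (⊔-identityʳ (length v))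
longest (v ∷ w ∷ A) _    with longest (w ∷ A) (λ ()) | ≤-total (maxLen (w ∷ A)) (length v)
... | _                | inj₁ shorter = v , here refl , sym (m≥n⇒m⊔n≡m shorter)
... | u , u∈A , eq     | inj₂ longer  = u , there u∈A , trans eq (sym (m≤n⇒m⊔n≡n longer))

corrSum≡corr : ∀ A (ends : All BeginsEndsWith1 A) m N →
  corrSum (aA A) m N ≡ Correlations.corr (parity A) (increment A) (parity-rec ends) (λ _ → false) m N
corrSum≡corr A ends m zero    = refl
corrSum≡corr A ends m (suc N) =
  cong₂ ℤ._+_ (corrSum≡corr A ends m N) (sym (sgn-xor (parity A N) (parity A (N + m))))

module _ (A : List Word) (uniq : Unique A) (ends : All BeginsEndsWith1 A) (L : ℕ) (maxLen≡ : maxLen A ≡ 2 + L) where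

  E : ℕ → Bool
  E = increment A

  open CorrelationBounds (parity A) E (parity-rec ends)

  -- By `increment-flip`, the shift by 2^(ℓ-1) changes the increment exactly if 1 followed by the
  -- last ℓ-1 digits of `x` lies in `A`. For odd `x` it does by fullness; for even `x` it ends in 0
  -- and does not.
  full⇒noncorrelated : (∀ u → length u ≡ L → frame u ∈ A) → Noncorrelated (aA A)
  full⇒noncorrelated full (suc d) _ k with Flipping.corr-negligible (2 ^ L) {{nonzero}} E-flip d k
    where
    nonzero : NonZero (2 ^ L + 2 ^ L)
    nonzero = subst NonZero (2^suc L) (m^n≢0 2 (suc L))
    flipped : ∀ b w → length w ≡ L → member A (true ∷ reverse (b ∷ w)) ≡ b
    flipped true w len = ∈⇒member uniq (subst (λ u → true ∷ u ∈ A) (sym (unfold-reverse true w))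
      (full (reverse w) (trans (length-reverse w) len)))
    flipped false w len = ∉⇒¬member A _ (λ w∈A → contradiction (trans
      (sym (trans (cong (λ u → lastW (true ∷ u)) (unfold-reverse false w)) (lastW-∷ʳ (true ∷ reverse w) false)))
      (proj₂ (All.lookup ends w∈A))) (λ ()))
    E-flip : ∀ x → E (x + (2 ^ L + 2 ^ L)) ≡ odd x xor E x
    E-flip x = begin
      E (x + (2 ^ L + 2 ^ L))                       ≡⟨ cong (λ p → E (x + p)) (2^suc L) ⟨
      E (x + 2 ^ suc L)                             ≡⟨ xor-identityʳ _ ⟨
      E (x + 2 ^ suc L) xor false                   ≡⟨ cong (E (x + 2 ^ suc L) xor_) (xor-same (E x)) ⟨
      E (x + 2 ^ suc L) xor (E x xor E x)           ≡⟨ xor-assoc (E (x + 2 ^ suc L)) (E x) (E x) ⟨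
      (E (x + 2 ^ suc L) xor E x) xor E x           ≡⟨ cong (_xor E x) (trans
                                                         (increment-flip ends (suc L) (≤-reflexive maxLen≡) x)
                                                         (flipped (odd x) (low L ⌊ x /2⌋) (length-low L _))) ⟩
      odd x xor E x                                 ∎
      where open ≡-Reasoning
  ... | N₀ , bound = N₀ , λ N N₀≤N →
    subst (λ z → ∣ z ∣ * suc k ≤ N) (sym (corrSum≡corr A ends (suc d) N)) (bound N N₀≤N)

  module _ (A≢[] : A ≢ []) (L≤3 : L ≤ 3) where

    -- A shift by 2^5 tests a word of length 6, longer than all words of `A`.
    E-periodic : Periodic 32 E
    E-periodic x = xor≡false⇒≡ _ _ (trans
      (increment-flip ends 5 (≤-trans (≤-reflexive maxLen≡) (≤-trans (+-monoʳ-≤ 2 L≤3) (n≤1+n 5))) x)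
      (long⇒¬member A _ (s≤s (≤-trans (≤-reflexive maxLen≡) (≤-trans (+-monoʳ-≤ 2 L≤3)
        (≤-reflexive (sym (trans (length-reverse (low 5 x)) (length-low 5 x)))))))))
      where
      xor≡false⇒≡ : ∀ a b → a xor b ≡ false → a ≡ b
      xor≡false⇒≡ true  true  _ = refl
      xor≡false⇒≡ false false _ = refl

    -- Replacing i by i + 2^k moves the odd number 2i+1 by 2^(k+1); `L ≤ k` ensures that the words
    -- of `A` are short enough for `increment-flip`.
    E-flip-odd : ∀ k i → L ≤ k → E (suc (i + 2 ^ k + (i + 2 ^ k))) xor E (suc (i + i)) ≡
      member A (true ∷ reverse (true ∷ low k i))
    E-flip-odd k i L≤k = begin
      E (suc (i + 2 ^ k + (i + 2 ^ k))) xor E (suc (i + i))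
        ≡⟨ cong (λ x → E (suc x) xor E (suc (i + i))) (trans
             (solve 2 (λ i p → i :+ p :+ (i :+ p) := i :+ i :+ (p :+ p)) refl i (2 ^ k))
             (cong (i + i +_) (sym (2^suc k)))) ⟩
      E (suc (i + i) + 2 ^ suc k) xor E (suc (i + i))
        ≡⟨ increment-flip ends (suc k) (≤-trans (≤-reflexive maxLen≡) (+-monoʳ-≤ 2 L≤k)) (suc (i + i)) ⟩
      member A (true ∷ reverse (low (suc k) (suc (i + i))))
        ≡⟨ cong₂ (λ b x → member A (true ∷ reverse (b ∷ low k x))) (cong not (odd-+double 0 i)) (⌊1+n+n/2⌋ i) ⟩
      member A (true ∷ reverse (true ∷ low k i)) ∎
      where
      open ≡-Reasoning
      open +-*-Solver

    E-odd f : ℕ → Bool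
    E-odd i = E (suc (i + i))
    f = table 16 E-odd !_

    f-jump : ∀ k i → L ≤ k → k ≤ 3 → i < 2 ^ k →
      f (i + 2 ^ k) xor f i ≡ member A (true ∷ reverse (true ∷ low k i))
    f-jump k i L≤k k≤3 i<2^k = trans
      (cong₂ _xor_ (table-! 16 E-odd (i + 2 ^ k) (<-≤-trans (+-monoˡ-< (2 ^ k) i<2^k) bound))
                   (table-! 16 E-odd i (≤-trans i<2^k (≤-trans (m≤m+n (2 ^ k) (2 ^ k)) bound))))
      (E-flip-odd k i L≤k)
      where
      bound : 2 ^ k + 2 ^ k ≤ 16
      bound = subst (_≤ 16) (2^suc k) (^-monoʳ-≤ 2 (s≤s k≤3))

    some-longest : ∃ λ u → length u ≡ L × frame u ∈ A
    some-longest with longest A A≢[]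
    ... | v , v∈A , len with unframe v (All.lookup ends v∈A) (≤-trans (m≤m+n 2 L) (≤-reflexive (sym (trans len maxLen≡))))
    ...   | u , refl = u , suc-injective (suc-injective (trans (sym (length-frame u)) (trans len maxLen≡))) , v∈A

    f-jump-frame : ∀ u → length u ≡ L → ∃ λ i → i < 2 ^ L × f (i + 2 ^ L) xor f i ≡ member A (frame u)
    f-jump-frame u refl = val (reverse u) , index< ,
      trans (f-jump L (val (reverse u)) ≤-refl L≤3 index<) (cong (member A) (frame-low u))
      where
      index< : val (reverse u) < 2 ^ length u
      index< = subst (λ k → val (reverse u) < 2 ^ k) (length-reverse u) (val< (reverse u))

    -- For k > L the jumps test words longer than ℓ, so they all vanish and the search descends. At
    -- k = L a longest word of `A` produces a jump, which leaves only the alternative that all jumps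
    -- occur.
    longest-full⇒full : ∀ k → L < k → k ≤ 4 → longest-full k f ≡ true → ∀ u → length u ≡ L → frame u ∈ A
    longest-full⇒full (suc k) (s≤s L≤k) (s≤s k≤3) ok u len
      with jumps (λ b → b) f k (2 ^ k) in full | m≤n⇒m<n∨m≡n L≤k
    ... | true | inj₂ refl = let i , i<2^k , jump = f-jump-frame u len in
      member⇒∈ A (frame u) (trans (sym jump) (jumps-sound (λ b → b) f k (2 ^ k) full i i<2^k))
    -- Index 0 suffices: a jump there would put a word longer than ℓ into `A`.
    ... | true | inj₁ L<k = contradiction
      (trans (sym (jumps-sound (λ b → b) f k (2 ^ k) full 0 (m^n>0 2 k)))
        (trans (f-jump k 0 L≤k k≤3 (m^n>0 2 k)) (long⇒¬member A _ too-long)))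
      λ ()
      where
      too-long : maxLen A < length (true ∷ reverse (true ∷ low k 0))
      too-long = begin-strict
        maxLen A                                   ≡⟨ maxLen≡ ⟩
        2 + L                                      <⟨ +-monoʳ-< 2 L<k ⟩
        2 + k                                      ≡⟨ cong (2 +_) (length-low k 0) ⟨
        2 + length (low k 0)                       ≡⟨ cong suc (length-reverse (true ∷ low k 0)) ⟨
        length (true ∷ reverse (true ∷ low k 0))   ∎
        where open ≤-Reasoning
    ... | false | inj₁ L<k = longest-full⇒full k L<k (m≤n⇒m≤1+n k≤3) (Bool.∧-conicalʳ _ _ ok) u len
    -- The second alternative claims that no jump occurs, against the jump at the index of a longest
    -- word.
    ... | false | inj₂ refl = let
        v , len-v , v∈A  = some-longest
        i , i<2^k , jump = f-jump-frame v len-v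
      in contradiction
        (trans (sym (jumps-sound not f k (2 ^ k) (Bool.∧-conicalˡ _ _ ok) i i<2^k))
          (cong not (trans jump (∈⇒member uniq v∈A))))
        λ ()

    noncorrelated⇒full : Noncorrelated (aA A) → ∀ u → length u ≡ L → frame u ∈ A
    noncorrelated⇒full noncorrelated = longest-full⇒full 4 (s≤s L≤3) ≤-refl
      (negligible⇒longest-full (parity A) E (parity-rec ends) (increment-even ends) E-periodic
        λ d 1≤d k → let N₀ , bound = noncorrelated d 1≤d k in
          N₀ , λ N N₀≤N → subst (λ z → ∣ z ∣ * suc k ≤ N) (corrSum≡corr A ends d N) (bound N N₀≤N))

theoremC : (A : List Word) → Unique A → A ≢ [] → All BeginsEndsWith1 A →
    ((2 ≤ maxLen A →
    (∀ (u : Word) → length u ≡ maxLen A ∸ 2 → (true ∷ u ++ true ∷ []) ∈ A) →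
    Noncorrelated (aA A))
    × (2 ≤ maxLen A → maxLen A ≤ 5 → Noncorrelated (aA A) →
    ∀ (u : Word) → length u ≡ maxLen A ∸ 2 → (true ∷ u ++ true ∷ []) ∈ A))
theoremC A uniq A≢[] ends =
  (λ 2≤ℓ → full⇒noncorrelated A uniq ends (maxLen A ∸ 2) (sym (m+[n∸m]≡n 2≤ℓ))) ,
  (λ 2≤ℓ ℓ≤5 → noncorrelated⇒full A uniq ends (maxLen A ∸ 2) (sym (m+[n∸m]≡n 2≤ℓ)) A≢[] (∸-monoˡ-≤ 2 ℓ≤5))
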